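{- The following series identity holds: $$\sum_{k=0}^{\infty}\left(\frac{ -1}{27}\right)^k\frac{(1)_k^2}{(\frac{7}{6})_k(\frac{11}{6})_k}\left\{\frac{83+192k+112k^2}{64(1+4k)(3+4k)}H_{k}^{(2)}-\frac{10+39k+48k^2+16k^3}{(1+4k)^3(3+4k)^3(5+6k)^{ -1}}\right\}=-\frac{15}{8}\beta(4).$$
   Context: For a complex number $x$ and a nonnegative integer $n$, the shifted factorial is $(x)_0=1$ and $(x)_n=x(x+1)\cdots(x+n-1)$ for $n\ge 1$; $(x)_n^m$ denotes $((x)_n)^m$. The harmonic numbers of order 2 are $H_n^{(2)}=\sum_{j=1}^n \frac{1}{j^2}$, with $H_0^{(2)}=0$. The constant $\beta(4)$ is $\beta(4)=\sum_{k=0}^{\infty}\frac{(-1)^k}{(1+2k)^4}$. The factor $(5+6k)^{ -1}$ in the denominator is the reciprocal of $5+6k$, i.e. the fraction equals $\frac{(5+6k)(10+39k+48k^2+16k^3)}{(1+4k)^3(3+4k)^3}$. -}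

module Defs where

open import Algebra.Definitions.RawSemiring as RawSemiring using ()
open import Data.Integer as ℤ using (+_)
import Data.Integer.Properties as ℤ
open import Data.Nat as ℕ using (ℕ; zero; suc; s≤s)
import Data.Nat.Properties as ℕ
open import Data.Nat.Tactic.RingSolver using (solve-∀)
open import Data.Product using (∃-syntax; _×_; _,_)
open import Data.Rational
open import Data.Rational.Properties
import Data.Rational.Unnormalised as ℚᵘ
import Data.Rational.Unnormalised.Properties as ℚᵘ
open import Data.Rational.Solver using (module +-*-Solver)
open import Data.Sum using (inj₁; inj₂)
open import Relation.Binary.PropositionalEquality

open RawSemiring +-*-rawSemiring public using (_^_)

-- ∑[ n ] f = f 0 + … + f (n - 1)
∑[_] : ℕ → (ℕ → ℚ) → ℚ
∑[ zero  ] f = 0ℚ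
∑[ suc n ] f = ∑[ n ] f + f n

-- (x)ₙ = x (x + 1) ⋯ (x + n - 1)
shifted : ℚ → ℕ → ℚ
shifted x zero    = 1ℚ
shifted x (suc n) = shifted x n * (x + + n / 1)

shifted-pos : ∀ x n → .{{Positive x}} → Positive (shifted x n)
shifted-pos x zero    = _
shifted-pos x (suc n) =
  pos*pos⇒pos (shifted x n) {{shifted-pos x n}} (x + + n / 1)
    {{pos+nonNeg⇒pos x (+ n / 1) {{normalize-nonNeg n 1}}}}

shifted-*-nonZero : ∀ x y n → .{{Positive x}} → .{{Positive y}} →
                    NonZero (shifted x n * shifted y n)
shifted-*-nonZero x y n =
  pos⇒nonZero (shifted x n * shifted y n)
    {{pos*pos⇒pos (shifted x n) {{shifted-pos x n}}
                  (shifted y n) {{shifted-pos y n}}}}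

-- The index of ∑[_] starts at 0, so j = i + 1 runs over 1, …, n.
H⁽²⁾ : ℕ → ℚ
H⁽²⁾ n = ∑[ n ] λ i → let j = suc i in + 1 / (j ℕ.^ 2)

------------------------------------------------------------------------
-- Real numbers as Cauchy sequences of rationals. Since there is no
-- quotient, equality of reals would be a setoid equality; convergence to
-- a real does not depend on the representative.

Cauchy : (ℕ → ℚ) → Set
Cauchy s = ∀ ε → 0ℚ < ε →
  ∃[ N ] ∀ m n → N ℕ.≤ m → N ℕ.≤ n → ∣ s m - s n ∣ < ε

record ℝ : Set where
  constructor mkℝ
  field
    seq    : ℕ → ℚ
    cauchy : Cauchy seq

open ℝ public

∣p-q∣≡∣q-p∣ : ∀ p q → ∣ p - q ∣ ≡ ∣ q - p ∣
∣p-q∣≡∣q-p∣ p q = trans (sym (∣-p∣≡∣p∣ (p - q))) (cong ∣_∣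
  (solve 2 (λ p q → :- (p :- q) := q :- p) refl p q))
  where open +-*-Solver

∣p∣-∣q∣≤∣p-q∣ : ∀ p q → ∣ p ∣ - ∣ q ∣ ≤ ∣ p - q ∣
∣p∣-∣q∣≤∣p-q∣ p q = begin
  ∣ p ∣ - ∣ q ∣                ≡⟨ cong (λ r → ∣ r ∣ - ∣ q ∣)
    (solve 2 (λ p q → p := (p :- q) :+ q) refl p q) ⟩
  ∣ (p - q) + q ∣ - ∣ q ∣      ≤⟨ +-monoˡ-≤ (- ∣ q ∣) (∣p+q∣≤∣p∣+∣q∣ (p - q) q) ⟩
  (∣ p - q ∣ + ∣ q ∣) - ∣ q ∣  ≡⟨
    solve 2 (λ a b → (a :+ b) :- b := a) refl ∣ p - q ∣ ∣ q ∣ ⟩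
  ∣ p - q ∣                    ∎
  where open ≤-Reasoning; open +-*-Solver

∣∣p∣-∣q∣∣≤∣p-q∣ : ∀ p q → ∣ ∣ p ∣ - ∣ q ∣ ∣ ≤ ∣ p - q ∣
∣∣p∣-∣q∣∣≤∣p-q∣ p q with ∣p∣≡p∨∣p∣≡-p (∣ p ∣ - ∣ q ∣)
... | inj₁ eq = subst (_≤ ∣ p - q ∣) (sym eq) (∣p∣-∣q∣≤∣p-q∣ p q)
... | inj₂ eq = subst₂ _≤_ (sym (trans eq flip)) (∣p-q∣≡∣q-p∣ q p) (∣p∣-∣q∣≤∣p-q∣ q p)
  where
  open +-*-Solver
  flip : - (∣ p ∣ - ∣ q ∣) ≡ ∣ q ∣ - ∣ p ∣
  flip = solve 2 (λ p q → :- (p :- q) := q :- p) refl ∣ p ∣ ∣ q ∣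

0<½*ε : ∀ {ε} → 0ℚ < ε → 0ℚ < ½ * ε
0<½*ε {ε} 0<ε = subst (_< ½ * ε) (*-zeroʳ ½) (*-monoʳ-<-pos ½ 0<ε)

½*ε+½*ε≡ε : ∀ ε → ½ * ε + ½ * ε ≡ ε
½*ε+½*ε≡ε ε = trans (sym (*-distribʳ-+ ε ½ ½)) (*-identityˡ ε)

fromℚ : ℚ → ℝ
fromℚ q = mkℝ (λ _ → q) λ ε 0<ε → 0 , λ _ _ _ _ →
  subst (_< ε) (sym (cong ∣_∣ (+-inverseʳ q))) 0<ε

infixl 6 _-ᴿ_
_-ᴿ_ : ℝ → ℝ → ℝ
x -ᴿ y = mkℝ (λ n → seq x n - seq y n) λ ε 0<ε →
  let Nx , x-close = cauchy x (½ * ε) (0<½*ε 0<ε)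
      Ny , y-close = cauchy y (½ * ε) (0<½*ε 0<ε)
  in Nx ℕ.⊔ Ny , λ m n N≤m N≤n → begin-strict
    ∣ (seq x m - seq y m) - (seq x n - seq y n) ∣  ≡⟨ cong ∣_∣
      (solve 4 (λ a b c d → (a :- b) :- (c :- d) := (a :- c) :- (b :- d)) refl
        (seq x m) (seq y m) (seq x n) (seq y n)) ⟩
    ∣ (seq x m - seq x n) - (seq y m - seq y n) ∣
      ≤⟨ ∣p-q∣≤∣p∣+∣q∣ (seq x m - seq x n) (seq y m - seq y n) ⟩
    ∣ seq x m - seq x n ∣ + ∣ seq y m - seq y n ∣
      <⟨ +-mono-< (x-close m n (ℕ.m⊔n≤o⇒m≤o Nx Ny N≤m) (ℕ.m⊔n≤o⇒m≤o Nx Ny N≤n))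
                  (y-close m n (ℕ.m⊔n≤o⇒n≤o Nx Ny N≤m) (ℕ.m⊔n≤o⇒n≤o Nx Ny N≤n)) ⟩
    ½ * ε + ½ * ε                                  ≡⟨ ½*ε+½*ε≡ε ε ⟩
    ε                                              ∎
  where open ≤-Reasoning; open +-*-Solver

∣_∣ᴿ : ℝ → ℝ
∣ x ∣ᴿ = mkℝ (λ n → ∣ seq x n ∣) λ ε 0<ε →
  let N , close = cauchy x ε 0<ε
  in N , λ m n N≤m N≤n →
    ≤-<-trans (∣∣p∣-∣q∣∣≤∣p-q∣ (seq x m) (seq x n)) (close m n N≤m N≤n)

infixl 7 _·_
_·_ : ℚ → ℝ → ℝ
q · x = mkℝ (λ n → q * seq x n) scaled
  where
  open ≤-Reasoning
  c : ℚ
  c = ∣ q ∣ + 1ℚ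
  instance
    c-pos : Positive c
    c-pos = nonNeg+pos⇒pos ∣ q ∣ {{∣-∣-nonNeg q}} 1ℚ
    c≢0 : NonZero c
    c≢0 = pos⇒nonZero c
    1/c-pos : Positive (1/ c)
    1/c-pos = 1/pos⇒pos c
  scaled : Cauchy (λ n → q * seq x n)
  scaled ε 0<ε =
    let N , close = cauchy x (1/ c * ε)
          (subst (_< 1/ c * ε) (*-zeroʳ (1/ c)) (*-monoʳ-<-pos (1/ c) 0<ε))
    in N , λ m n N≤m N≤n → begin-strict
      ∣ q * seq x m - q * seq x n ∣  ≡⟨ cong ∣_∣
        (solve 3 (λ q a b → q :* a :- q :* b := q :* (a :- b)) refl q (seq x m) (seq x n)) ⟩
      ∣ q * (seq x m - seq x n) ∣    ≡⟨ ∣p*q∣≡∣p∣*∣q∣ q (seq x m - seq x n) ⟩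
      ∣ q ∣ * ∣ seq x m - seq x n ∣
        ≤⟨ *-monoʳ-≤-nonNeg ∣ seq x m - seq x n ∣ {{∣-∣-nonNeg (seq x m - seq x n)}}
             (subst (_≤ c) (+-identityʳ ∣ q ∣) (+-monoʳ-≤ ∣ q ∣ (nonNegative⁻¹ 1ℚ))) ⟩
      c * ∣ seq x m - seq x n ∣      <⟨ *-monoʳ-<-pos c (close m n N≤m N≤n) ⟩
      c * (1/ c * ε)                 ≡⟨ sym (*-assoc c (1/ c) ε) ⟩
      c * 1/ c * ε                   ≡⟨ cong (_* ε) (*-inverseʳ c) ⟩
      1ℚ * ε                         ≡⟨ *-identityˡ ε ⟩
      ε                              ∎
    where open +-*-Solver

-- The uniform gap δ makes this the strict order of the reals and not just
-- termwise strict inequality.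
infix 4 _<ᴿ_
_<ᴿ_ : ℝ → ℝ → Set
x <ᴿ y = ∃[ δ ] (0ℚ < δ) × ∃[ N ] ∀ n → N ℕ.≤ n → seq x n + δ ≤ seq y n

-- The reals are Archimedean, so rational ε suffice.
_⟶_ : (ℕ → ℝ) → ℝ → Set
u ⟶ x = ∀ ε → 0ℚ < ε → ∃[ N ] ∀ n → N ℕ.≤ n → ∣ u n -ᴿ x ∣ᴿ <ᴿ fromℚ ε

-- The series ∑ₖ f k converges and its sum is x.
HasSum : (ℕ → ℚ) → ℝ → Set
HasSum f x = (λ n → fromℚ (∑[ n ] f)) ⟶ x

-- The partial sums of a series represent its sum.
∑∞ : (f : ℕ → ℚ) → Cauchy (λ n → ∑[ n ] f) → ℝ
∑∞ f c = mkℝ (λ n → ∑[ n ] f) c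

∑∞-hasSum : ∀ f c → HasSum f (∑∞ f c)
∑∞-hasSum f c ε 0<ε =
  let N , close = c (½ * ε) (0<½*ε 0<ε)
  in N , λ n N≤n → ½ * ε , 0<½*ε 0<ε , N , λ m N≤m →
    subst (∣ ∑[ n ] f - ∑[ m ] f ∣ + ½ * ε ≤_) (½*ε+½*ε≡ε ε)
      (+-monoˡ-≤ (½ * ε) (<⇒≤ (close n m N≤n N≤m)))

------------------------------------------------------------------------
-- β(4)

β4-term : ℕ → ℚ
β4-term k = (- 1ℚ) ^ k * (+ 1 / (1 ℕ.+ 2 ℕ.* k) ℕ.^ 4)

-- Cauchy because ∣β4-term k∣ ≤ bound k - bound (k + 1), which telescopes.
bound : ℕ → ℚ
bound k = + 2 / suc k

∣-1^k∣≡1 : ∀ k → ∣ (- 1ℚ) ^ k ∣ ≡ 1ℚ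
∣-1^k∣≡1 zero    = refl
∣-1^k∣≡1 (suc k) = trans (∣p*q∣≡∣p∣*∣q∣ (- 1ℚ) ((- 1ℚ) ^ k))
  (trans (*-identityˡ ∣ (- 1ℚ) ^ k ∣) (∣-1^k∣≡1 k))

/-cross-≤ : ∀ a b c d e f .{{_ : ℕ.NonZero b}} .{{_ : ℕ.NonZero d}} .{{_ : ℕ.NonZero f}} →
            (a ℕ.* d ℕ.+ c ℕ.* b) ℕ.* f ℕ.≤ e ℕ.* (b ℕ.* d) →
            + a / b + + c / d ≤ + e / f
/-cross-≤ a b@(suc _) c d@(suc _) e f@(suc _) le = toℚᵘ-cancel-≤ (begin
  toℚᵘ (+ a / b + + c / d)               ≃⟨ toℚᵘ-homo-+ (+ a / b) (+ c / d) ⟩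
  toℚᵘ (+ a / b) ℚᵘ.+ toℚᵘ (+ c / d)
    ≃⟨ ℚᵘ.+-cong (toℚᵘ-fromℚᵘ (+ a ℚᵘ./ b)) (toℚᵘ-fromℚᵘ (+ c ℚᵘ./ d)) ⟩
  (+ a ℚᵘ./ b) ℚᵘ.+ (+ c ℚᵘ./ d)         ≤⟨ ℚᵘ.*≤* (subst₂ ℤ._≤_ lhs (ℤ.pos-* e (b ℕ.* d)) (ℤ.+≤+ le)) ⟩
  + e ℚᵘ./ f                             ≃⟨ ℚᵘ.≃-sym (toℚᵘ-fromℚᵘ (+ e ℚᵘ./ f)) ⟩
  toℚᵘ (+ e / f)                         ∎)
  where
  open ℚᵘ.≤-Reasoning
  lhs : + ((a ℕ.* d ℕ.+ c ℕ.* b) ℕ.* f) ≡ (+ a ℤ.* + d ℤ.+ + c ℤ.* + b) ℤ.* + f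
  lhs = trans (ℤ.pos-* (a ℕ.* d ℕ.+ c ℕ.* b) f)
    (cong (ℤ._* + f) (cong₂ ℤ._+_ (ℤ.pos-* a d) (ℤ.pos-* c b)))

∣β4-term∣+bound≤bound : ∀ k → ∣ β4-term k ∣ + bound (suc k) ≤ bound k
∣β4-term∣+bound≤bound k = subst (λ t → t + bound (suc k) ≤ bound k) (sym abs)
  (/-cross-≤ 1 ((1 ℕ.+ 2 ℕ.* k) ℕ.^ 4) 2 (2 ℕ.+ k) 2 (suc k)
    (subst (lhs k ℕ.≤_) (gap k) (ℕ.m≤m+n (lhs k) _)))
  where
  lhs : ℕ → ℕ
  lhs k = (1 ℕ.* (2 ℕ.+ k) ℕ.+ 2 ℕ.* (1 ℕ.+ 2 ℕ.* k) ℕ.^ 4) ℕ.* suc k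
  -- The solver does not handle powers of compound terms.
  gap : ∀ k →
    (1 ℕ.* (2 ℕ.+ k)
      ℕ.+ 2 ℕ.* ((1 ℕ.+ 2 ℕ.* k) ℕ.* ((1 ℕ.+ 2 ℕ.* k) ℕ.* ((1 ℕ.+ 2 ℕ.* k) ℕ.* ((1 ℕ.+ 2 ℕ.* k) ℕ.* 1))))) ℕ.* (1 ℕ.+ k)
      ℕ.+ (13 ℕ.* k ℕ.+ 47 ℕ.* (k ℕ.* k) ℕ.+ 64 ℕ.* (k ℕ.* k ℕ.* k) ℕ.+ 32 ℕ.* (k ℕ.* k ℕ.* k ℕ.* k))
    ≡ 2 ℕ.* (((1 ℕ.+ 2 ℕ.* k) ℕ.* ((1 ℕ.+ 2 ℕ.* k) ℕ.* ((1 ℕ.+ 2 ℕ.* k) ℕ.* ((1 ℕ.+ 2 ℕ.* k) ℕ.* 1)))) ℕ.* (2 ℕ.+ k))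
  gap = solve-∀
  r : ℚ
  r = + 1 / (1 ℕ.+ 2 ℕ.* k) ℕ.^ 4
  abs : ∣ β4-term k ∣ ≡ r
  abs = begin
    ∣ (- 1ℚ) ^ k * r ∣      ≡⟨ ∣p*q∣≡∣p∣*∣q∣ ((- 1ℚ) ^ k) r ⟩
    ∣ (- 1ℚ) ^ k ∣ * ∣ r ∣  ≡⟨ cong (_* ∣ r ∣) (∣-1^k∣≡1 k) ⟩
    1ℚ * ∣ r ∣              ≡⟨ *-identityˡ ∣ r ∣ ⟩
    ∣ r ∣                   ≡⟨ 0≤p⇒∣p∣≡p (nonNegative⁻¹ r
                                 {{normalize-nonNeg 1 ((1 ℕ.+ 2 ℕ.* k) ℕ.^ 4)}}) ⟩
    r                       ∎
    where open ≡-Reasoning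

∣∑β4∣≤bound : ∀ m j →
  ∣ ∑[ j ℕ.+ m ] β4-term - ∑[ m ] β4-term ∣ + bound (j ℕ.+ m) ≤ bound m
∣∑β4∣≤bound m zero = ≤-reflexive (trans
  (cong (_+ bound m) (cong ∣_∣ (+-inverseʳ (∑[ m ] β4-term)))) (+-identityˡ (bound m)))
∣∑β4∣≤bound m (suc j) = begin
  ∣ (S + t) - S₀ ∣ + b′        ≡⟨ cong (λ r → ∣ r ∣ + b′)
    (solve 3 (λ s t s₀ → (s :+ t) :- s₀ := (s :- s₀) :+ t) refl S t S₀) ⟩
  ∣ (S - S₀) + t ∣ + b′        ≤⟨ +-monoˡ-≤ b′ (∣p+q∣≤∣p∣+∣q∣ (S - S₀) t) ⟩
  (∣ S - S₀ ∣ + ∣ t ∣) + b′    ≡⟨ +-assoc ∣ S - S₀ ∣ ∣ t ∣ b′ ⟩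
  ∣ S - S₀ ∣ + (∣ t ∣ + b′)    ≤⟨ +-monoʳ-≤ ∣ S - S₀ ∣ (∣β4-term∣+bound≤bound (j ℕ.+ m)) ⟩
  ∣ S - S₀ ∣ + bound (j ℕ.+ m) ≤⟨ ∣∑β4∣≤bound m j ⟩
  bound m                      ∎
  where
  open ≤-Reasoning
  open +-*-Solver
  S  = ∑[ j ℕ.+ m ] β4-term
  S₀ = ∑[ m ] β4-term
  t  = β4-term (j ℕ.+ m)
  b′ = bound (suc (j ℕ.+ m))

bound<ε : ∀ ε → 0ℚ < ε → ∃[ N ] ∀ m → N ℕ.≤ m → bound m < ε
bound<ε (mkℚ (+ zero) _ _) (*<* (ℤ.+<+ ()))
bound<ε (mkℚ (ℤ.-[1+ _ ]) _ _) (*<* ())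
bound<ε ε@(mkℚ (+ suc p) d _) _ = 2 ℕ.* suc d , λ m N≤m → toℚᵘ-cancel-<
  (ℚᵘ.<-respˡ-≃ (ℚᵘ.≃-sym (toℚᵘ-fromℚᵘ (+ 2 ℚᵘ./ suc m)))
    (ℚᵘ.*<* (subst₂ ℤ._<_ (ℤ.pos-* 2 (suc d)) (ℤ.pos-* (suc p) (suc m))
      (ℤ.+<+ (ℕ.≤-trans (s≤s N≤m) (ℕ.m≤n*m (suc m) (suc p)))))))

β4-close : ∀ ε N → (∀ m → N ℕ.≤ m → bound m < ε) → ∀ m n → N ℕ.≤ m → m ℕ.≤ n →
           ∣ ∑[ n ] β4-term - ∑[ m ] β4-term ∣ < ε
β4-close ε N small m n N≤m m≤n = begin-strict
  D                ≡⟨ sym (+-identityʳ D) ⟩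
  D + 0ℚ           ≤⟨ +-monoʳ-≤ D (nonNegative⁻¹ (bound n) {{normalize-nonNeg 2 (suc n)}}) ⟩
  D + bound n      ≤⟨ subst (λ l → ∣ ∑[ l ] β4-term - ∑[ m ] β4-term ∣ + bound l ≤ bound m)
                       (ℕ.m∸n+n≡m m≤n) (∣∑β4∣≤bound m (n ℕ.∸ m)) ⟩
  bound m          <⟨ small m N≤m ⟩
  ε                ∎
  where
  open ≤-Reasoning
  D = ∣ ∑[ n ] β4-term - ∑[ m ] β4-term ∣

β4-cauchy : Cauchy (λ n → ∑[ n ] β4-term)
β4-cauchy ε 0<ε with bound<ε ε 0<ε
... | N , small = N , close
  where
  close : ∀ m n → N ℕ.≤ m → N ℕ.≤ n → ∣ ∑[ m ] β4-term - ∑[ n ] β4-term ∣ < ε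
  close m n N≤m N≤n with ℕ.≤-total m n
  ... | inj₁ m≤n = subst (_< ε) (∣p-q∣≡∣q-p∣ (∑[ n ] β4-term) (∑[ m ] β4-term))
                     (β4-close ε N small m n N≤m m≤n)
  ... | inj₂ n≤m = β4-close ε N small n m N≤n n≤m

β4 : ℝ
β4 = ∑∞ β4-term β4-cauchy

{-# OPTIONS --safe #-}
-- Write M = 2 (n + s) + 1 and let F n s be the coefficient of x in
--
--   (-1)ˢ ∏_{j = 1}^{n} ((2j)² - x) / ∏_{i = 0}^{2n} (2 (s + i) + 1) · M / (M² - x),
--
-- so that F 0 s = (-1)ˢ / (2s + 1)⁴. Since M is the same for F (n + 1) (s + 1)
-- and F n (s + 2), the splitting (2n + 2)² - x = (M² - x) - (M² - (2n + 2)²) shows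
-- that these two differ by g n s - g n (s + 1), where g n s is rational in s and h n.
-- Hence T n K = ∑_{k < K} F n (n + k) satisfies
--
--   T n (K + 2) = G n + T (n + 1) K + g n (n + K),   G n = F n n + F n (n + 1) - g n n,
--
-- and starting from T 0 (2N), a partial sum of β(4), N steps leave ∑_{n < N} G n
-- plus N values of g of size at most 1 / (N + 1)². Finally the k-th term of the
-- series is - (15 / 8) G k.

module Submission where

open import Defs
open import Data.Integer as ℤ using (+_; -1ℤ)
import Data.Integer.Properties as ℤ
open import Data.Nat as ℕ using (ℕ; zero; suc)
import Data.Nat.Properties as ℕ
import Data.Nat.Tactic.RingSolver as ℕ-Solver
open import Data.Product using (_,_)
open import Data.Rational
open import Data.Rational.Properties
import Data.Rational.Unnormalised as ℚᵘ
import Data.Rational.Unnormalised.Properties as ℚᵘ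
open import Data.Rational.Solver using (module +-*-Solver)
open import Relation.Binary.PropositionalEquality

-- Natural numbers as rationals, and fractions.

opaque
  -- Opaque, so that `ι n` stays an atom for the type checker and the ring solver instead of
  -- unfolding to a normalised fraction; `ι-def` gives the value where it is needed.
  ι : ℕ → ℚ
  ι n = + n / 1

  ι-def : ∀ n → ι n ≡ + n / 1
  ι-def n = refl

  ι-+ : ∀ m n → ι (m ℕ.+ n) ≡ ι m + ι n
  ι-+ m n = toℚᵘ-injective (begin
    toℚᵘ (+ (m ℕ.+ n) / 1)                ≈⟨ toℚᵘ-fromℚᵘ (+ (m ℕ.+ n) ℚᵘ./ 1) ⟩
    + (m ℕ.+ n) ℚᵘ./ 1                    ≈⟨ ℚᵘ.*≡* (cong (ℤ._* + 1) (sym (cong₂ ℤ._+_ (ℤ.*-identityʳ (+ m)) (ℤ.*-identityʳ (+ n))))) ⟩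
    (+ m ℚᵘ./ 1) ℚᵘ.+ (+ n ℚᵘ./ 1)        ≈⟨ ℚᵘ.+-cong (toℚᵘ-fromℚᵘ (+ m ℚᵘ./ 1)) (toℚᵘ-fromℚᵘ (+ n ℚᵘ./ 1)) ⟨
    toℚᵘ (+ m / 1) ℚᵘ.+ toℚᵘ (+ n / 1)    ≈⟨ toℚᵘ-homo-+ (+ m / 1) (+ n / 1) ⟨
    toℚᵘ (+ m / 1 + + n / 1)              ∎)
    where open ℚᵘ.≃-Reasoning

  ι-* : ∀ m n → ι (m ℕ.* n) ≡ ι m * ι n
  ι-* m n = toℚᵘ-injective (begin
    toℚᵘ (+ (m ℕ.* n) / 1)                ≈⟨ toℚᵘ-fromℚᵘ (+ (m ℕ.* n) ℚᵘ./ 1) ⟩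
    + (m ℕ.* n) ℚᵘ./ 1                    ≈⟨ ℚᵘ.*≡* (cong (ℤ._* + 1) (ℤ.pos-* m n)) ⟩
    (+ m ℚᵘ./ 1) ℚᵘ.* (+ n ℚᵘ./ 1)        ≈⟨ ℚᵘ.*-cong (toℚᵘ-fromℚᵘ (+ m ℚᵘ./ 1)) (toℚᵘ-fromℚᵘ (+ n ℚᵘ./ 1)) ⟨
    toℚᵘ (+ m / 1) ℚᵘ.* toℚᵘ (+ n / 1)    ≈⟨ toℚᵘ-homo-* (+ m / 1) (+ n / 1) ⟨
    toℚᵘ (+ m / 1 * (+ n / 1))            ∎)
    where open ℚᵘ.≃-Reasoning

  /-*-cancel : ∀ a d .{{_ : ℕ.NonZero d}} → + a / d * ι d ≡ ι a
  /-*-cancel a d@(suc _) = toℚᵘ-injective (begin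
    toℚᵘ (+ a / d * (+ d / 1))            ≈⟨ toℚᵘ-homo-* (+ a / d) (+ d / 1) ⟩
    toℚᵘ (+ a / d) ℚᵘ.* toℚᵘ (+ d / 1)    ≈⟨ ℚᵘ.*-cong (toℚᵘ-fromℚᵘ (+ a ℚᵘ./ d)) (toℚᵘ-fromℚᵘ (+ d ℚᵘ./ 1)) ⟩
    (+ a ℚᵘ./ d) ℚᵘ.* (+ d ℚᵘ./ 1)        ≈⟨ ℚᵘ.*≡* (trans (ℤ.*-identityʳ (+ a ℤ.* + d)) (cong (λ m → + a ℤ.* + m) (sym (ℕ.*-identityʳ d)))) ⟩
    + a ℚᵘ./ 1                            ≈⟨ toℚᵘ-fromℚᵘ (+ a ℚᵘ./ 1) ⟨
    toℚᵘ (+ a / 1)                        ∎)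
    where open ℚᵘ.≃-Reasoning

  ι-nonNeg : ∀ n → NonNegative (ι n)
  ι-nonNeg n = normalize-nonNeg n 1

ι-suc : ∀ n → ι (suc n) ≡ 1ℚ + ι n
ι-suc n = trans (ι-+ 1 n) (cong (_+ ι n) (ι-def 1))

ι-^2 : ∀ k → ι (k ℕ.^ 2) ≡ ι k * ι k
ι-^2 k = trans (ι-* k (k ℕ.* 1)) (cong (λ j → ι k * ι j) (ℕ.*-identityʳ k))

1/-*-cancel : ∀ d .{{_ : ℕ.NonZero d}} → + 1 / d * ι d ≡ 1ℚ
1/-*-cancel d = trans (/-*-cancel 1 d) (ι-def 1)

-- `+ 1 / d` inverts `ι d`, so `ι d` can be cancelled. Fractions with a symbolic denominator are
-- evaluated through this, which leaves equations free of division.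
/-unique : ∀ x a d .{{_ : ℕ.NonZero d}} → x * ι d ≡ ι a → + a / d ≡ x
/-unique x a d eq = begin
  + a / d                      ≡⟨ *-identityʳ _ ⟨
  + a / d * 1ℚ                 ≡⟨ cong (+ a / d *_) (1/-*-cancel d) ⟨
  + a / d * (+ 1 / d * ι d)    ≡⟨ swap (+ a / d) (+ 1 / d) (ι d) ⟩
  + a / d * ι d * (+ 1 / d)    ≡⟨ cong (_* (+ 1 / d)) (trans (/-*-cancel a d) (sym eq)) ⟩
  x * ι d * (+ 1 / d)          ≡⟨ swap x (+ 1 / d) (ι d) ⟨
  x * (+ 1 / d * ι d)          ≡⟨ cong (x *_) (1/-*-cancel d) ⟩
  x * 1ℚ                       ≡⟨ *-identityʳ x ⟩
  x                            ∎
  where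
  open ≡-Reasoning
  open +-*-Solver
  swap : ∀ x y z → x * (y * z) ≡ x * z * y
  swap = solve 3 (λ x y z → x :* (y :* z) := x :* z :* y) refl

-- Products of odd and even numbers, and the functions F and g.

odd⁻¹ : ℕ → ℚ
odd⁻¹ i = + 1 / (1 ℕ.+ 2 ℕ.* i)

odd⁻¹-inverse : ∀ i → odd⁻¹ i * (1ℚ + (ι i + ι i)) ≡ 1ℚ
odd⁻¹-inverse i = trans (cong (odd⁻¹ i *_) (sym ι-odd)) (1/-*-cancel (1 ℕ.+ 2 ℕ.* i))
  where
  ι-odd : ι (1 ℕ.+ 2 ℕ.* i) ≡ 1ℚ + (ι i + ι i)
  ι-odd = trans (ι-suc (2 ℕ.* i)) (cong (λ x → 1ℚ + x)
    (trans (ι-+ i (i ℕ.+ 0)) (cong (λ j → ι i + ι j) (ℕ.+-identityʳ i))))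

oddProduct⁻¹ : ℕ → ℕ → ℚ
oddProduct⁻¹ a zero    = 1ℚ
oddProduct⁻¹ a (suc m) = oddProduct⁻¹ a m * odd⁻¹ (a ℕ.+ m)

-- The definition splits off the last factor; shifting the starting index of a product needs the
-- first one.
oddProduct⁻¹-suc : ∀ a m → oddProduct⁻¹ a (suc m) ≡ odd⁻¹ a * oddProduct⁻¹ (suc a) m
oddProduct⁻¹-suc a zero = trans (*-comm 1ℚ (odd⁻¹ (a ℕ.+ 0)))
  (cong (λ i → odd⁻¹ i * 1ℚ) (ℕ.+-identityʳ a))
oddProduct⁻¹-suc a (suc m) = begin
  oddProduct⁻¹ a (suc m) * odd⁻¹ (a ℕ.+ suc m)
    ≡⟨ cong₂ (λ q i → q * odd⁻¹ i) (oddProduct⁻¹-suc a m) (ℕ.+-suc a m) ⟩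
  odd⁻¹ a * oddProduct⁻¹ (suc a) m * odd⁻¹ (suc a ℕ.+ m)
    ≡⟨ *-assoc (odd⁻¹ a) (oddProduct⁻¹ (suc a) m) (odd⁻¹ (suc a ℕ.+ m)) ⟩
  odd⁻¹ a * oddProduct⁻¹ (suc a) (suc m) ∎
  where open ≡-Reasoning

evens² : ℕ → ℚ
evens² zero    = 1ℚ
evens² (suc n) = evens² n * ((ι (suc n) + ι (suc n)) * (ι (suc n) + ι (suc n)))

-- This is the sum of 1 / (2j)² for j = 1, ..., n, so that ∏ ((2j)² - x) is `evens² n` times 1 -
-- `h n` x modulo x².
h : ℕ → ℚ
h n = + 1 / 4 * H⁽²⁾ n

sign : ℕ → ℚ
sign n = (- 1ℚ) ^ n

sign-suc : ∀ n → sign (suc n) ≡ - sign n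
sign-suc n = trans (sym (neg-distribˡ-* 1ℚ (sign n))) (cong -_ (*-identityˡ (sign n)))

-- Modulo x², M / (M² - x) is a + a³ x with a = 1 / M. Multiplied by 1 - `h n` x, this has the
-- coefficient a³ - `h n` a at x.
F : ℕ → ℕ → ℚ
F n s = sign s * (evens² n * oddProduct⁻¹ s (1 ℕ.+ n ℕ.* 2))
      * (a * a * a - h n * a)
  where a = odd⁻¹ (n ℕ.+ s)

g : ℕ → ℕ → ℚ
g n s = ½ * sign s * (evens² n * oddProduct⁻¹ (suc s) (2 ℕ.+ n ℕ.* 2) * h n)

-- The recurrence between F (n + 1) and F n.

-- Compare the coefficients of x on the two sides of w² (1 - `h (suc n)` x) = (w² - x) (1 - `h n`
-- x), which holds modulo x².
h-suc : ∀ n → let w = ι (suc n) + ι (suc n) in w * w * h (suc n) ≡ w * w * h n + 1ℚ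
h-suc n = begin
  w * w * (+ 1 / 4 * (H⁽²⁾ n + r))
    ≡⟨ solve 3 (λ m H r → (m :+ m) :* (m :+ m) :* (con (+ 1 / 4) :* (H :+ r))
                     := (m :+ m) :* (m :+ m) :* (con (+ 1 / 4) :* H) :+ r :* (m :* m))
         refl m (H⁽²⁾ n) r ⟩
  w * w * h n + r * (m * m)     ≡⟨ cong (λ x → w * w * h n + r * x) (ι-^2 (suc n)) ⟨
  w * w * h n + r * ι (suc n ℕ.^ 2) ≡⟨ cong (λ x → w * w * h n + x) (1/-*-cancel (suc n ℕ.^ 2)) ⟩
  w * w * h n + 1ℚ              ∎
  where
  open ≡-Reasoning
  open +-*-Solver
  m = ι (suc n)
  w = m + m
  r = + 1 / (suc n ℕ.^ 2)

-- The coefficient of x in (1 - h x) (w² - x) M / ((M² - w²) (M² - x)), after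
-- w² - x = (M² - x) - (M² - w²) and 2 M / (M² - w²) = 1 / (M - w) + 1 / (M + w).
partial-fractions : ∀ M w α β a h → α * (M - w) ≡ 1ℚ → β * (M + w) ≡ 1ℚ → a * M ≡ 1ℚ →
  w * w * (α * β) * (a * a * a - h * a) - α * β * a ≡ - (a * a * a - h * a) - ½ * (h * (α + β))
partial-fractions M w α β a h α-inv β-inv a-inv = begin
  w * w * (α * β) * X - α * β * a
    ≡⟨ solve 6 (λ w α β a X h → w :* w :* (α :* β) :* X :- α :* β :* a
         := (w :* w :* (α :* β) :* X :+ X :* (con 1ℚ :* con 1ℚ) :- α :* β :* a
              :+ con ½ :* (h :* (α :* con 1ℚ :+ β :* con 1ℚ)))
            :- X :- con ½ :* (h :* (α :+ β))) refl w α β a X h ⟩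
  L 1ℚ 1ℚ - X - ½ * (h * (α + β))
    ≡⟨ cong₂ (λ x y → L x y - X - ½ * (h * (α + β))) (sym α-inv) (sym β-inv) ⟩
  L (α * (M - w)) (β * (M + w)) - X - ½ * (h * (α + β))
    ≡⟨ cong (λ x → x - X - ½ * (h * (α + β)))
         (solve 6 (λ M w α β a h → let X = a :* a :* a :- h :* a; u = α :* (M :- w); v = β :* (M :+ w) in
             w :* w :* (α :* β) :* X :+ X :* (u :* v) :- α :* β :* a
              :+ con ½ :* (h :* (α :* v :+ β :* u))
           := α :* β :* (a :* ((a :* M) :* (a :* M) :- con 1ℚ)
                 :- h :* M :* (a :* M :- con 1ℚ)))
           refl M w α β a h) ⟩
  R (a * M) - X - ½ * (h * (α + β))
    ≡⟨ cong (λ x → R x - X - ½ * (h * (α + β))) a-inv ⟩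
  R 1ℚ - X - ½ * (h * (α + β))
    ≡⟨ solve 7 (λ M w α β a X h →
           α :* β :* (a :* (con 1ℚ :* con 1ℚ :- con 1ℚ) :- h :* M :* (con 1ℚ :- con 1ℚ))
             :- X :- con ½ :* (h :* (α :+ β))
           := :- X :- con ½ :* (h :* (α :+ β))) refl M w α β a X h ⟩
  - X - ½ * (h * (α + β)) ∎
  where
  open ≡-Reasoning
  open +-*-Solver
  X = a * a * a - h * a
  -- The arguments stand for `α * (M - w)` and `β * (M + w)`, both equal to 1. Once these replace
  -- the units, every term carries the factor `α * β`, and the rest is `R (a * M)`, which vanishes
  -- because `a * M` is 1.
  L : ℚ → ℚ → ℚ
  L u v = w * w * (α * β) * X + X * (u * v) - α * β * a + ½ * (h * (α * v + β * u))
  R : ℚ → ℚ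
  R x = α * β * (a * (x * x - 1ℚ) - h * M * (x - 1ℚ))

-- The outermost factors `α` and `β` of the odd product on the left are 1 / (M - w) and 1 / (M + w)
-- with w = 2 (n + 1). `partial-fractions` trades them for three terms, in which `q`, `q * β` and
-- `α * q` are the odd products of `F n (suc (suc s))`, `g n (suc s)` and `g n s`.
F-suc : ∀ n s → F (suc n) (suc s) ≡ F n (suc (suc s)) - g n (suc s) + g n s
F-suc n s = begin
  F (suc n) (suc s)
    ≡⟨ cong₂ (λ t q → t * (p * (w * w) * (q * β)) * (b * b * b - h (suc n) * b))
         (sign-suc s) (oddProduct⁻¹-suc (suc s) (1 ℕ.+ n ℕ.* 2)) ⟩
  - τ * (p * (w * w) * (α * q * β)) * (b * b * b - h (suc n) * b)
    ≡⟨ solve 8 (λ τ p w α q β b h′ →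
          :- τ :* (p :* (w :* w) :* (α :* q :* β)) :* (b :* b :* b :- h′ :* b)
          := :- τ :* (p :* q) :* (w :* w :* (α :* β) :* (b :* b :* b) :- w :* w :* h′ :* (α :* β :* b)))
          refl τ p w α q β b (h (suc n)) ⟩
  - τ * (p * q) * (w * w * (α * β) * (b * b * b) - w * w * h (suc n) * (α * β * b))
    ≡⟨ cong₂ (λ b x → - τ * (p * q) * (w * w * (α * β) * (b * b * b) - x * (α * β * b)))
         (cong odd⁻¹ (sym (ℕ.+-suc n (suc s)))) (h-suc n) ⟩
  - τ * (p * q) * (w * w * (α * β) * (a * a * a) - (w * w * h n + 1ℚ) * (α * β * a))
    ≡⟨ cong (- τ * (p * q) *_)
         (solve 5 (λ w α β a h → w :* w :* (α :* β) :* (a :* a :* a) :- (w :* w :* h :+ con 1ℚ) :* (α :* β :* a)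
          := w :* w :* (α :* β) :* (a :* a :* a :- h :* a) :- α :* β :* a) refl w α β a (h n)) ⟩
  - τ * (p * q) * (w * w * (α * β) * (a * a * a - h n * a) - α * β * a)
    ≡⟨ cong (- τ * (p * q) *_) (partial-fractions M w α β a (h n) α-inv β-inv a-inv) ⟩
  - τ * (p * q) * (- (a * a * a - h n * a) - ½ * (h n * (α + β)))
    ≡⟨ solve 7 (λ τ p q a h α β →
          :- τ :* (p :* q) :* (:- (a :* a :* a :- h :* a) :- con ½ :* (h :* (α :+ β)))
          := (:- :- τ) :* (p :* q) :* (a :* a :* a :- h :* a)
             :- con ½ :* (:- τ) :* (p :* (q :* β) :* h) :+ con ½ :* τ :* (p :* (α :* q) :* h))
          refl τ p q a (h n) α β ⟩
  (- - τ) * (p * q) * (a * a * a - h n * a) - ½ * (- τ) * (p * (q * β) * h n)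
    + ½ * τ * (p * (α * q) * h n)
    ≡⟨ cong₂ (λ x y → x * (p * q) * (a * a * a - h n * a) - ½ * y * (p * (q * β) * h n)
          + ½ * τ * (p * (α * q) * h n))
        (trans (cong -_ (sym (sign-suc s))) (sym (sign-suc (suc s)))) (sym (sign-suc s)) ⟩
  F n (suc (suc s)) - ½ * sign (suc s) * (p * (q * β) * h n) + ½ * τ * (p * (α * q) * h n)
    ≡⟨ cong₂ (λ x y → F n (suc (suc s)) - ½ * sign (suc s) * (p * (q * x) * h n) + ½ * τ * (p * y * h n))
        (cong odd⁻¹ (ℕ.+-suc (suc s) (1 ℕ.+ n ℕ.* 2)))
        (sym (oddProduct⁻¹-suc (suc s) (1 ℕ.+ n ℕ.* 2))) ⟩
  F n (suc (suc s)) - g n (suc s) + g n s ∎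
  where
  open ≡-Reasoning
  open +-*-Solver
  τ = sign s
  p = evens² n
  w = ι (suc n) + ι (suc n)
  α = odd⁻¹ (suc s)
  q = oddProduct⁻¹ (suc (suc s)) (1 ℕ.+ n ℕ.* 2)
  β = odd⁻¹ (suc s ℕ.+ suc (suc (n ℕ.* 2)))
  a = odd⁻¹ (n ℕ.+ suc (suc s))
  b = odd⁻¹ (suc n ℕ.+ suc s)
  N = ι n
  S = ι s
  M = 1ℚ + ((N + (1ℚ + (1ℚ + S))) + (N + (1ℚ + (1ℚ + S))))
  ι-ss : ι (suc (suc s)) ≡ 1ℚ + (1ℚ + S)
  ι-ss = trans (ι-suc (suc s)) (cong (λ x → 1ℚ + x) (ι-suc s))
  a-inv : a * M ≡ 1ℚ
  a-inv = trans (cong (λ x → a * (1ℚ + (x + x))) (sym (trans (ι-+ n (suc (suc s))) (cong (λ x → N + x) ι-ss))))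
    (odd⁻¹-inverse (n ℕ.+ suc (suc s)))
  α-inv : α * (M - w) ≡ 1ℚ
  α-inv = trans (cong (α *_) (trans
      (cong (λ x → M - (x + x)) (ι-suc n))
      (trans (solve 2 (λ N S → let T = N :+ (con 1ℚ :+ (con 1ℚ :+ S)); U = con 1ℚ :+ N; V = con 1ℚ :+ S in
         con 1ℚ :+ (T :+ T) :- (U :+ U) := con 1ℚ :+ (V :+ V)) refl N S)
       (cong (λ x → 1ℚ + (x + x)) (sym (ι-suc s))))))
    (odd⁻¹-inverse (suc s))
  β-inv : β * (M + w) ≡ 1ℚ
  β-inv = trans (cong (β *_) (trans
      (cong (λ x → M + (x + x)) (ι-suc n))
      (trans (solve 2 (λ N S → let T = N :+ (con 1ℚ :+ (con 1ℚ :+ S)); U = con 1ℚ :+ N; V = (con 1ℚ :+ S) :+ (con 1ℚ :+ (con 1ℚ :+ N :* con (+ 2 / 1))) in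
         con 1ℚ :+ (T :+ T) :+ (U :+ U) := con 1ℚ :+ (V :+ V)) refl N S)
       (cong (λ x → 1ℚ + (x + x)) (sym ι-β)))))
    (odd⁻¹-inverse (suc s ℕ.+ suc (suc (n ℕ.* 2))))
    where
    ι-β : ι (suc s ℕ.+ suc (suc (n ℕ.* 2))) ≡ (1ℚ + S) + (1ℚ + (1ℚ + N * (+ 2 / 1)))
    ι-β = trans (ι-+ (suc s) _) (cong₂ _+_ (ι-suc s) (trans (ι-suc _) (cong (λ x → 1ℚ + x) (trans (ι-suc _)
      (cong (λ x → 1ℚ + x) (trans (ι-* n 2) (cong (N *_) (ι-def 2))))))))

-- Summation of the recurrence and the remaining error.

∑-suc : ∀ K f → ∑[ suc K ] f ≡ f 0 + ∑[ K ] (λ k → f (suc k))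
∑-suc zero    f = +-comm 0ℚ (f 0)
∑-suc (suc K) f = trans (cong (λ x → x + f (suc K)) (∑-suc K f))
  (+-assoc (f 0) (∑[ K ] (λ k → f (suc k))) (f (suc K)))

∑-cong : ∀ {f g} → (∀ k → f k ≡ g k) → ∀ n → ∑[ n ] f ≡ ∑[ n ] g
∑-cong eq zero    = refl
∑-cong eq (suc n) = cong₂ _+_ (∑-cong eq n) (eq n)

∑-*ˡ : ∀ c f n → ∑[ n ] (λ k → c * f k) ≡ c * ∑[ n ] f
∑-*ˡ c f zero    = sym (*-zeroʳ c)
∑-*ˡ c f (suc n) = trans (cong (λ x → x + c * f n) (∑-*ˡ c f n)) (sym (*-distribˡ-+ c (∑[ n ] f) (f n)))

G : ℕ → ℚ
G n = F n n + F n (suc n) - g n n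

T : ℕ → ℕ → ℚ
T n K = ∑[ K ] λ k → F n (n ℕ.+ k)

-- Sum `F-suc` over s = n + k: the values of `g` telescope and only the two ends survive.
T-suc : ∀ n K →
  T (suc n) K ≡ ∑[ K ] (λ k → F n (n ℕ.+ suc (suc k))) - g n (n ℕ.+ K) + g n n
T-suc n zero = trans (sym (+-inverseˡ (g n n)))
  (cong (λ x → x + g n n) (trans (cong (λ s → - g n s) (sym (ℕ.+-identityʳ n)))
    (sym (+-identityˡ (- g n (n ℕ.+ 0))))))
T-suc n (suc K) = begin
  T (suc n) K + F (suc n) (suc (n ℕ.+ K))
    ≡⟨ cong₂ _+_ (T-suc n K) (F-suc n (n ℕ.+ K)) ⟩
  (S - g n (n ℕ.+ K) + g n n) + (F n (suc (suc (n ℕ.+ K))) - g n (suc (n ℕ.+ K)) + g n (n ℕ.+ K))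
    ≡⟨ solve 5 (λ S x y f z → (S :- x :+ y) :+ (f :- z :+ x) := S :+ f :- z :+ y) refl
         S (g n (n ℕ.+ K)) (g n n) (F n (suc (suc (n ℕ.+ K)))) (g n (suc (n ℕ.+ K))) ⟩
  S + F n (suc (suc (n ℕ.+ K))) - g n (suc (n ℕ.+ K)) + g n n
    ≡⟨ cong₂ (λ s t → S + F n s - g n t + g n n)
         (sym (trans (ℕ.+-suc n (suc K)) (cong suc (ℕ.+-suc n K)))) (sym (ℕ.+-suc n K)) ⟩
  S + F n (n ℕ.+ suc (suc K)) - g n (n ℕ.+ suc K) + g n n ∎
  where
  open ≡-Reasoning
  open +-*-Solver
  S = ∑[ K ] (λ k → F n (n ℕ.+ suc (suc k)))

-- The first two terms go into `G n`; the others, with their index shifted by two, are what `T-suc`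
-- expresses through `T (suc n) K`.
T-split : ∀ n K → T n (suc (suc K)) ≡ G n + T (suc n) K + g n (n ℕ.+ K)
T-split n K = begin
  T n (suc (suc K))
    ≡⟨ trans (∑-suc (suc K) (λ k → F n (n ℕ.+ k)))
         (cong (λ x → F n (n ℕ.+ 0) + x) (∑-suc K (λ k → F n (n ℕ.+ suc k)))) ⟩
  F n (n ℕ.+ 0) + (F n (n ℕ.+ 1) + S)
    ≡⟨ cong₂ (λ s t → F n s + (F n t + S)) (ℕ.+-identityʳ n) (ℕ.+-comm n 1) ⟩
  F n n + (F n (suc n) + S)
    ≡⟨ solve 5 (λ f f′ S x y → f :+ (f′ :+ S) := f :+ f′ :- y :+ (S :- x :+ y) :+ x) refl
         (F n n) (F n (suc n)) S (g n (n ℕ.+ K)) (g n n) ⟩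
  G n + (S - g n (n ℕ.+ K) + g n n) + g n (n ℕ.+ K)
    ≡⟨ cong (λ x → G n + x + g n (n ℕ.+ K)) (T-suc n K) ⟨
  G n + T (suc n) K + g n (n ℕ.+ K) ∎
  where
  open ≡-Reasoning
  open +-*-Solver
  S = ∑[ K ] (λ k → F n (n ℕ.+ suc (suc k)))

-- Collects the boundary values of `g` when `T-split` is applied j times to `T n (j * 2)`. Each
-- application uses up two terms of the sum, hence the index `j ℕ.* 2`.
error : ℕ → ℕ → ℚ
error n zero    = 0ℚ
error n (suc j) = error (suc n) j + g n (n ℕ.+ j ℕ.* 2)

-- Each step of the induction extracts one `G` by `T-split`; after j steps the sum `T` is empty.
∑G : ∀ j n → ∑[ j ℕ.+ n ] G ≡ ∑[ n ] G + T n (j ℕ.* 2) - error n j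
∑G zero n = solve 1 (λ x → x := x :+ con 0ℚ :- con 0ℚ) refl (∑[ n ] G)
  where open +-*-Solver
∑G (suc j) n = begin
  ∑[ suc j ℕ.+ n ] G
    ≡⟨ cong (λ m → ∑[ m ] G) (ℕ.+-suc j n) ⟨
  ∑[ j ℕ.+ suc n ] G
    ≡⟨ ∑G j (suc n) ⟩
  ∑[ n ] G + G n + T (suc n) (j ℕ.* 2) - error (suc n) j
    ≡⟨ solve 5 (λ s g t x y → s :+ g :+ t :- x := s :+ (g :+ t :+ y) :- (x :+ y)) refl
         (∑[ n ] G) (G n) (T (suc n) (j ℕ.* 2)) (error (suc n) j) (g n (n ℕ.+ j ℕ.* 2)) ⟩
  ∑[ n ] G + (G n + T (suc n) (j ℕ.* 2) + g n (n ℕ.+ j ℕ.* 2)) - error n (suc j)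
    ≡⟨ cong (λ x → ∑[ n ] G + x - error n (suc j)) (T-split n (j ℕ.* 2)) ⟨
  ∑[ n ] G + T n (suc j ℕ.* 2) - error n (suc j) ∎
  where
  open ≡-Reasoning
  open +-*-Solver

-- For n = 0 the even product is empty and `h 0` vanishes, so 1 / M comes from the odd product and 1
-- / M³ from the last factor.
F-zero : ∀ k → F 0 k ≡ β4-term k
F-zero k = begin
  sign k * (1ℚ * (1ℚ * odd⁻¹ (k ℕ.+ 0))) * (a * a * a - h 0 * a)
    ≡⟨ cong (λ i → sign k * (1ℚ * (1ℚ * odd⁻¹ i)) * (a * a * a - h 0 * a)) (ℕ.+-identityʳ k) ⟩
  sign k * (1ℚ * (1ℚ * a)) * (a * a * a - 0ℚ * a)
    ≡⟨ solve 2 (λ t a → t :* (con 1ℚ :* (con 1ℚ :* a)) :* (a :* a :* a :- con 0ℚ :* a)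
         := t :* (a :* (a :* (a :* a)))) refl (sign k) a ⟩
  sign k * (a * (a * (a * a)))
    ≡⟨ cong (sign k *_) (/-unique (a * (a * (a * a))) 1 (d ℕ.^ 4) a⁴) ⟨
  β4-term k ∎
  where
  open ≡-Reasoning
  open +-*-Solver
  d = 1 ℕ.+ 2 ℕ.* k
  a = odd⁻¹ k
  D = ι d
  aD : a * D ≡ 1ℚ
  aD = 1/-*-cancel d
  a⁴ : a * (a * (a * a)) * ι (d ℕ.^ 4) ≡ ι 1
  a⁴ = begin
    a * (a * (a * a)) * ι (d ℕ.^ 4)
      ≡⟨ cong (a * (a * (a * a)) *_)
          (trans (ι-* d (d ℕ.^ 3)) (cong (D *_) (trans (ι-* d (d ℕ.^ 2)) (cong (D *_)
            (trans (ι-* d (d ℕ.* 1)) (cong (λ x → D * ι x) (ℕ.*-identityʳ d))))))) ⟩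
    a * (a * (a * a)) * (D * (D * (D * D)))
      ≡⟨ solve 2 (λ a D → a :* (a :* (a :* a)) :* (D :* (D :* (D :* D)))
            := (a :* D) :* ((a :* D) :* ((a :* D) :* (a :* D)))) refl a D ⟩
    (a * D) * ((a * D) * ((a * D) * (a * D)))
      ≡⟨ cong (λ x → x * (x * (x * x))) aD ⟩
    1ℚ
      ≡⟨ ι-def 1 ⟨
    ι 1 ∎

T-zero : ∀ K → T 0 K ≡ ∑[ K ] β4-term
T-zero = ∑-cong F-zero

-- The error tends to zero.

ι-nonneg : ∀ n → 0ℚ ≤ ι n
ι-nonneg n = nonNegative⁻¹ (ι n) {{ι-nonNeg n}}

*-nonneg : ∀ {x y} → 0ℚ ≤ x → 0ℚ ≤ y → 0ℚ ≤ x * y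
*-nonneg {x} {y} 0≤x 0≤y = subst (_≤ x * y) (*-zeroʳ x) (*-monoˡ-≤-nonNeg x {{nonNegative 0≤x}} 0≤y)

*-mono-≤ : ∀ {x y u v} → 0ℚ ≤ u → 0ℚ ≤ y → x ≤ y → u ≤ v → x * u ≤ y * v
*-mono-≤ {x} {y} {u} {v} 0≤u 0≤y x≤y u≤v = ≤-trans
  (*-monoʳ-≤-nonNeg u {{nonNegative 0≤u}} x≤y) (*-monoˡ-≤-nonNeg y {{nonNegative 0≤y}} u≤v)

ι-mono : ∀ {m n} → m ℕ.≤ n → ι m ≤ ι n
ι-mono {m} {n} m≤n = begin
  ι m                  ≡⟨ +-identityʳ (ι m) ⟨
  ι m + 0ℚ             ≤⟨ +-monoʳ-≤ (ι m) (ι-nonneg (n ℕ.∸ m)) ⟩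
  ι m + ι (n ℕ.∸ m)    ≡⟨ ι-+ m (n ℕ.∸ m) ⟨
  ι (m ℕ.+ (n ℕ.∸ m))  ≡⟨ cong ι (ℕ.m+[n∸m]≡n m≤n) ⟩
  ι n                  ∎
  where open ≤-Reasoning

1/-nonneg : ∀ d .{{_ : ℕ.NonZero d}} → 0ℚ ≤ + 1 / d
1/-nonneg d = nonNegative⁻¹ (+ 1 / d) {{normalize-nonNeg 1 d}}

ι*1/≤1 : ∀ m d .{{_ : ℕ.NonZero d}} → m ℕ.≤ d → ι m * (+ 1 / d) ≤ 1ℚ
ι*1/≤1 m d m≤d = ≤-trans
  (*-monoʳ-≤-nonNeg (+ 1 / d) {{normalize-nonNeg 1 d}} (ι-mono m≤d))
  (≤-reflexive (trans (*-comm (ι d) (+ 1 / d)) (1/-*-cancel d)))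

1/-antimono : ∀ m d .{{_ : ℕ.NonZero m}} .{{_ : ℕ.NonZero d}} → m ℕ.≤ d → + 1 / d ≤ + 1 / m
1/-antimono m d m≤d = begin
  + 1 / d                        ≡⟨ *-identityˡ (+ 1 / d) ⟨
  1ℚ * (+ 1 / d)                 ≡⟨ cong (_* (+ 1 / d)) (1/-*-cancel m) ⟨
  + 1 / m * ι m * (+ 1 / d)      ≡⟨ *-assoc (+ 1 / m) (ι m) (+ 1 / d) ⟩
  + 1 / m * (ι m * (+ 1 / d))    ≤⟨ *-monoˡ-≤-nonNeg (+ 1 / m) {{normalize-nonNeg 1 m}} (ι*1/≤1 m d m≤d) ⟩
  + 1 / m * 1ℚ                   ≡⟨ *-identityʳ (+ 1 / m) ⟩
  + 1 / m                        ∎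
  where open ≤-Reasoning

oddProduct⁻¹-nonneg : ∀ a m → 0ℚ ≤ oddProduct⁻¹ a m
oddProduct⁻¹-nonneg a zero    = nonNegative⁻¹ 1ℚ
oddProduct⁻¹-nonneg a (suc m) = *-nonneg (oddProduct⁻¹-nonneg a m) (1/-nonneg (1 ℕ.+ 2 ℕ.* (a ℕ.+ m)))

evens²-nonneg : ∀ n → 0ℚ ≤ evens² n
evens²-nonneg zero    = nonNegative⁻¹ 1ℚ
evens²-nonneg (suc n) = *-nonneg (evens²-nonneg n) (*-nonneg 0≤w 0≤w)
  where
  0≤w : 0ℚ ≤ ι (suc n) + ι (suc n)
  0≤w = +-mono-≤ (ι-nonneg (suc n)) (ι-nonneg (suc n))

H⁽²⁾-nonneg : ∀ n → 0ℚ ≤ H⁽²⁾ n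
H⁽²⁾-nonneg zero    = ≤-refl
H⁽²⁾-nonneg (suc n) = +-mono-≤ (H⁽²⁾-nonneg n) (1/-nonneg (suc n ℕ.^ 2))

-- Every summand is at most 1. This crude bound suffices because `R-bound` leaves room for a factor
-- i + 1.
H⁽²⁾≤ι : ∀ n → H⁽²⁾ n ≤ ι n
H⁽²⁾≤ι zero    = ι-nonneg 0
H⁽²⁾≤ι (suc n) = ≤-trans
  (+-mono-≤ (H⁽²⁾≤ι n) (1/-antimono 1 (suc n ℕ.^ 2) (ℕ.s≤s ℕ.z≤n)))
  (≤-reflexive (trans (+-comm (ι n) 1ℚ) (sym (ι-suc n))))

r : ℕ → ℚ
r n = + 1 / suc n

-- Up to sign, `g i (i + l * 2)` is `½ * (R i l * h i)`; these are the arguments of `g` that occur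
-- in `error`.
R : ℕ → ℕ → ℚ
R i l = evens² i * oddProduct⁻¹ (suc (i ℕ.+ l ℕ.* 2)) (2 ℕ.+ i ℕ.* 2)

R-nonneg : ∀ i l → 0ℚ ≤ R i l
R-nonneg i l = *-nonneg (evens²-nonneg i) (oddProduct⁻¹-nonneg (suc (i ℕ.+ l ℕ.* 2)) (2 ℕ.+ i ℕ.* 2))

-- Induction on i with i + l kept fixed: dropping the two outermost odd factors of `R (suc i) l`
-- leaves the odd product of `R i (suc l)`. The dropped factors absorb the even numbers 2 (i + 1)
-- and 2 (i + 2), where the second comes from the weight `ι (suc (suc i))`. For i = 0 two odd
-- reciprocals remain, each at most 1 / (l + 2).
R-bound : ∀ i l → R i l * ι (suc i) ≤ r (suc (i ℕ.+ l)) * r (suc (i ℕ.+ l))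
R-bound zero l = begin
  1ℚ * (1ℚ * x * y) * ι 1     ≡⟨ cong (1ℚ * (1ℚ * x * y) *_) (ι-def 1) ⟩
  1ℚ * (1ℚ * x * y) * 1ℚ      ≡⟨ solve 2 (λ x y → con 1ℚ :* (con 1ℚ :* x :* y) :* con 1ℚ := x :* y) refl x y ⟩
  x * y                       ≤⟨ *-mono-≤ (1/-nonneg (1 ℕ.+ 2 ℕ.* (suc (l ℕ.* 2) ℕ.+ 1)))
       (1/-nonneg (2 ℕ.+ l))
       (1/-antimono (2 ℕ.+ l) (1 ℕ.+ 2 ℕ.* (suc (l ℕ.* 2) ℕ.+ 0))
         (subst (2 ℕ.+ l ℕ.≤_) (lem₁ l) (ℕ.m≤m+n (2 ℕ.+ l) _)))
       (1/-antimono (2 ℕ.+ l) (1 ℕ.+ 2 ℕ.* (suc (l ℕ.* 2) ℕ.+ 1))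
         (subst (2 ℕ.+ l ℕ.≤_) (lem₂ l) (ℕ.m≤m+n (2 ℕ.+ l) _))) ⟩
  r (suc l) * r (suc l)       ∎
  where
  open ≤-Reasoning
  open +-*-Solver
  x = odd⁻¹ (suc (l ℕ.* 2) ℕ.+ 0)
  y = odd⁻¹ (suc (l ℕ.* 2) ℕ.+ 1)
  lem₁ : ∀ l → 2 ℕ.+ l ℕ.+ (1 ℕ.+ 3 ℕ.* l) ≡ 1 ℕ.+ 2 ℕ.* (suc (l ℕ.* 2) ℕ.+ 0)
  lem₁ = ℕ-Solver.solve-∀
  lem₂ : ∀ l → 2 ℕ.+ l ℕ.+ (3 ℕ.+ 3 ℕ.* l) ≡ 1 ℕ.+ 2 ℕ.* (suc (l ℕ.* 2) ℕ.+ 1)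
  lem₂ = ℕ-Solver.solve-∀
R-bound (suc i) l = begin
  p * (w * w) * oddProduct⁻¹ s (4 ℕ.+ i ℕ.* 2) * ι (suc (suc i))
    ≡⟨ cong (λ q → p * (w * w) * (q * β) * ι (suc (suc i))) (oddProduct⁻¹-suc s (2 ℕ.+ i ℕ.* 2)) ⟩
  p * (w * w) * (α * q * β) * ι (suc (suc i))
    -- With m = i + 1 and n = i + 2, the factor 4 m² n is split as m · (2m) · (2n): m is the weight
    -- for i, while 2m and 2n are paired with `α` and `β`.
    ≡⟨ solve 6 (λ p m α q β n → p :* ((m :+ m) :* (m :+ m)) :* (α :* q :* β) :* n
         := p :* q :* m :* (((m :+ m) :* α) :* ((n :+ n) :* β))) refl
         p (ι (suc i)) α q β (ι (suc (suc i))) ⟩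
  p * q * ι (suc i) * ((w * α) * (w′ * β))
    ≤⟨ *-monoˡ-≤-nonNeg (p * q * ι (suc i)) {{nonNegative (*-nonneg (*-nonneg (evens²-nonneg i) (oddProduct⁻¹-nonneg (suc s) (2 ℕ.+ i ℕ.* 2))) (ι-nonneg (suc i)))}}
         (*-mono-≤ {v = 1ℚ} (*-nonneg (+-mono-≤ (ι-nonneg (suc (suc i))) (ι-nonneg (suc (suc i))))
                     (1/-nonneg (1 ℕ.+ 2 ℕ.* (s ℕ.+ (3 ℕ.+ i ℕ.* 2))))) (nonNegative⁻¹ 1ℚ) wα≤1 w′β≤1) ⟩
  p * q * ι (suc i) * 1ℚ
    ≡⟨ *-identityʳ (p * q * ι (suc i)) ⟩
  p * q * ι (suc i)
    ≡⟨ cong (λ t → p * oddProduct⁻¹ (suc t) (2 ℕ.+ i ℕ.* 2) * ι (suc i))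
         (sym (trans (ℕ.+-suc i (suc (l ℕ.* 2))) (cong suc (ℕ.+-suc i (l ℕ.* 2))))) ⟩
  R i (suc l) * ι (suc i)
    ≤⟨ R-bound i (suc l) ⟩
  r (suc (i ℕ.+ suc l)) * r (suc (i ℕ.+ suc l))
    ≡⟨ cong (λ t → r (suc t) * r (suc t)) (ℕ.+-suc i l) ⟩
  r (suc (suc i ℕ.+ l)) * r (suc (suc i ℕ.+ l)) ∎
  where
  open ≤-Reasoning
  open +-*-Solver
  p = evens² i
  w = ι (suc i) + ι (suc i)
  w′ = ι (suc (suc i)) + ι (suc (suc i))
  s = suc (suc i ℕ.+ l ℕ.* 2)
  α = odd⁻¹ s
  q = oddProduct⁻¹ (suc s) (2 ℕ.+ i ℕ.* 2)
  β = odd⁻¹ (s ℕ.+ (3 ℕ.+ i ℕ.* 2))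
  lem₁ : ∀ i l → suc i ℕ.+ suc i ℕ.+ (3 ℕ.+ 4 ℕ.* l) ≡ 1 ℕ.+ 2 ℕ.* (suc (suc i ℕ.+ l ℕ.* 2))
  lem₁ = ℕ-Solver.solve-∀
  lem₂ : ∀ i l → 2 ℕ.+ i ℕ.+ (2 ℕ.+ i) ℕ.+ (7 ℕ.+ 4 ℕ.* i ℕ.+ 4 ℕ.* l)
    ≡ 1 ℕ.+ 2 ℕ.* (suc (suc i ℕ.+ l ℕ.* 2) ℕ.+ (3 ℕ.+ i ℕ.* 2))
  lem₂ = ℕ-Solver.solve-∀
  wα≤1 : w * α ≤ 1ℚ
  wα≤1 = subst (λ x → x * α ≤ 1ℚ) (ι-+ (suc i) (suc i))
    (ι*1/≤1 (suc i ℕ.+ suc i) (1 ℕ.+ 2 ℕ.* s) (subst (suc i ℕ.+ suc i ℕ.≤_) (lem₁ i l) (ℕ.m≤m+n _ _)))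
  w′β≤1 : w′ * β ≤ 1ℚ
  w′β≤1 = subst (λ x → x * β ≤ 1ℚ) (ι-+ (2 ℕ.+ i) (2 ℕ.+ i))
    (ι*1/≤1 (2 ℕ.+ i ℕ.+ (2 ℕ.+ i)) (1 ℕ.+ 2 ℕ.* (s ℕ.+ (3 ℕ.+ i ℕ.* 2)))
      (subst (2 ℕ.+ i ℕ.+ (2 ℕ.+ i) ℕ.≤_) (lem₂ i l) (ℕ.m≤m+n _ _)))

∣g∣≤r² : ∀ i l → ∣ g i (i ℕ.+ l ℕ.* 2) ∣ ≤ r (suc (i ℕ.+ l)) * r (suc (i ℕ.+ l))
∣g∣≤r² i l = begin
  ∣ ½ * t * (R i l * h i) ∣
    ≡⟨ cong ∣_∣ (solve 3 (λ t R H → con ½ :* t :* (R :* (con (+ 1 / 4) :* H)) := t :* (R :* (con (+ 1 / 8) :* H))) refl t (R i l) (H⁽²⁾ i)) ⟩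
  ∣ t * (R i l * (+ 1 / 8 * H⁽²⁾ i)) ∣
    ≡⟨ ∣p*q∣≡∣p∣*∣q∣ t (R i l * (+ 1 / 8 * H⁽²⁾ i)) ⟩
  ∣ t ∣ * ∣ R i l * (+ 1 / 8 * H⁽²⁾ i) ∣
    ≡⟨ cong₂ _*_ (∣-1^k∣≡1 (i ℕ.+ l ℕ.* 2)) (0≤p⇒∣p∣≡p (*-nonneg (R-nonneg i l) (*-nonneg (nonNegative⁻¹ (+ 1 / 8)) (H⁽²⁾-nonneg i)))) ⟩
  1ℚ * (R i l * (+ 1 / 8 * H⁽²⁾ i))
    ≡⟨ *-identityˡ _ ⟩
  R i l * (+ 1 / 8 * H⁽²⁾ i)
    ≤⟨ *-monoˡ-≤-nonNeg (R i l) {{nonNegative (R-nonneg i l)}} (begin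
         + 1 / 8 * H⁽²⁾ i    ≤⟨ *-monoʳ-≤-nonNeg (H⁽²⁾ i) {{nonNegative (H⁽²⁾-nonneg i)}} (1/-antimono 1 8 (ℕ.s≤s ℕ.z≤n)) ⟩
         1ℚ * H⁽²⁾ i         ≡⟨ *-identityˡ (H⁽²⁾ i) ⟩
         H⁽²⁾ i              ≤⟨ H⁽²⁾≤ι i ⟩
         ι i                 ≤⟨ ι-mono (ℕ.n≤1+n i) ⟩
         ι (suc i)           ∎) ⟩
  R i l * ι (suc i)
    ≤⟨ R-bound i l ⟩
  r (suc (i ℕ.+ l)) * r (suc (i ℕ.+ l)) ∎
  where
  open ≤-Reasoning
  open +-*-Solver
  t = sign (i ℕ.+ l ℕ.* 2)

-- The recursion of `error` raises n and lowers j, so n + j is constant and all j values of `g` obey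
-- the same bound.
∣error∣≤ι*r² : ∀ n j → ∣ error n j ∣ ≤ ι j * (r (n ℕ.+ j) * r (n ℕ.+ j))
∣error∣≤ι*r² n zero    = *-nonneg (ι-nonneg 0) (*-nonneg (1/-nonneg (suc (n ℕ.+ 0))) (1/-nonneg (suc (n ℕ.+ 0))))
∣error∣≤ι*r² n (suc j) = begin
  ∣ error (suc n) j + g n (n ℕ.+ j ℕ.* 2) ∣
    ≤⟨ ∣p+q∣≤∣p∣+∣q∣ (error (suc n) j) (g n (n ℕ.+ j ℕ.* 2)) ⟩
  ∣ error (suc n) j ∣ + ∣ g n (n ℕ.+ j ℕ.* 2) ∣
    ≤⟨ +-mono-≤ (∣error∣≤ι*r² (suc n) j) (∣g∣≤r² n j) ⟩
  ι j * (x * x) + x * x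
    ≡⟨ solve 2 (λ m y → m :* y :+ y := (con 1ℚ :+ m) :* y) refl (ι j) (x * x) ⟩
  (1ℚ + ι j) * (x * x)
    ≡⟨ cong₂ (λ m t → m * (r t * r t)) (ι-suc j) (ℕ.+-suc n j) ⟨
  ι (suc j) * (r (n ℕ.+ suc j) * r (n ℕ.+ suc j)) ∎
  where
  open ≤-Reasoning
  open +-*-Solver
  x = r (suc (n ℕ.+ j))

∣error∣≤bound : ∀ n → ∣ error 0 n ∣ ≤ bound n
∣error∣≤bound n = begin
  ∣ error 0 n ∣        ≤⟨ ∣error∣≤ι*r² 0 n ⟩
  ι n * (r n * r n)    ≡⟨ *-assoc (ι n) (r n) (r n) ⟨
  ι n * r n * r n      ≤⟨ *-monoʳ-≤-nonNeg (r n) {{normalize-nonNeg 1 (suc n)}} (ι*1/≤1 n (suc n) (ℕ.n≤1+n n)) ⟩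
  1ℚ * r n             ≡⟨ trans (*-identityˡ (r n)) (sym (+-identityʳ (r n))) ⟩
  -- The estimate is doubled to reach `bound`, for which `bound<ε` already gives convergence to
  -- zero.
  r n + 0ℚ             ≤⟨ +-monoʳ-≤ (r n) (1/-nonneg (suc n)) ⟩
  r n + r n            ≡⟨ /-unique (r n + r n) 2 (suc n) (trans (*-distribʳ-+ (ι (suc n)) (r n) (r n))
                            (trans (cong₂ _+_ (1/-*-cancel (suc n)) (1/-*-cancel (suc n))) (sym (ι-def 2)))) ⟨
  bound n              ∎
  where open ≤-Reasoning

-- Closed form of G k.

odd⁻¹-inverse-at : ∀ i x → ι i ≡ x → odd⁻¹ i * (1ℚ + (x + x)) ≡ 1ℚ
odd⁻¹-inverse-at i x refl = odd⁻¹-inverse i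

-- This is 1 / ((2k + 3) (2k + 5) ⋯ (6k + 5)), the odd product of `g k k`; those of `F k k` and
-- `F k (suc k)` are polynomial multiples of it.
Q : ℕ → ℚ
Q k = oddProduct⁻¹ (suc k) (2 ℕ.+ k ℕ.* 2)

ι-k*2 : ∀ k → ι (k ℕ.* 2) ≡ ι k + ι k
ι-k*2 k = trans (cong ι (trans (ℕ.*-comm k 2) (cong (k ℕ.+_) (ℕ.+-identityʳ k)))) (ι-+ k k)

ι-3k : ∀ k c → ι (suc k ℕ.+ (c ℕ.+ k ℕ.* 2)) ≡ (1ℚ + ι k) + (ι c + (ι k + ι k))
ι-3k k c = trans (ι-+ (suc k) (c ℕ.+ k ℕ.* 2))
    (cong₂ _+_ (ι-suc k) (trans (ι-+ c (k ℕ.* 2)) (cong (λ x → ι c + x) (ι-k*2 k))))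

-- The odd number with index 3k + 1 + c is 6k + 3 + 2c; c = 1, 2, 3, 4 give the factors 6k + 5, 6k +
-- 7, 6k + 9 and 6k + 11.
inverse-3k : ∀ k c → odd⁻¹ (suc k ℕ.+ (c ℕ.+ k ℕ.* 2)) * ((+ 3 / 1 + (ι c + ι c)) + + 6 / 1 * ι k) ≡ 1ℚ
inverse-3k k c = trans (cong (odd⁻¹ (suc k ℕ.+ (c ℕ.+ k ℕ.* 2)) *_)
    (solve 2 (λ K C → let x = (con 1ℚ :+ K) :+ (C :+ (K :+ K)) in
         (con (+ 3 / 1) :+ (C :+ C)) :+ con (+ 6 / 1) :* K := con 1ℚ :+ (x :+ x)) refl (ι k) (ι c)))
    (odd⁻¹-inverse-at _ _ (ι-3k k c))
    where open +-*-Solver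

-- Passing from k to k + 1 removes 2k + 3 from the denominator and adds 6k + 7, 6k + 9 and 6k + 11,
-- where 6k + 9 = 3 (2k + 3).
Q-suc : ∀ k → let K = ι k in
  Q (suc k) * (+ 3 / 1 * ((+ 7 / 1 + + 6 / 1 * K) * (+ 11 / 1 + + 6 / 1 * K))) ≡ Q k
Q-suc k = begin
  q′ * (+ 3 / 1 * ((+ 7 / 1 + + 6 / 1 * K) * (+ 11 / 1 + + 6 / 1 * K)))
    ≡⟨ expand q′ _ ⟩
  1ℚ * q′ * (+ 3 / 1 * ((+ 7 / 1 + + 6 / 1 * K) * (+ 11 / 1 + + 6 / 1 * K)))
    ≡⟨ cong (λ x → x * q′ * (+ 3 / 1 * ((+ 7 / 1 + + 6 / 1 * K) * (+ 11 / 1 + + 6 / 1 * K)))) o-inv ⟨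
  o * (+ 3 / 1 + + 2 / 1 * K) * q′ * (+ 3 / 1 * ((+ 7 / 1 + + 6 / 1 * K) * (+ 11 / 1 + + 6 / 1 * K)))
    ≡⟨ solve 3 (λ o K q → o :* (con (+ 3 / 1) :+ con (+ 2 / 1) :* K) :* q
            :* (con (+ 3 / 1) :* ((con (+ 7 / 1) :+ con (+ 6 / 1) :* K) :* (con (+ 11 / 1) :+ con (+ 6 / 1) :* K)))
        := o :* q :* ((con (+ 7 / 1) :+ con (+ 6 / 1) :* K) :* ((con (+ 9 / 1) :+ con (+ 6 / 1) :* K) :* (con (+ 11 / 1) :+ con (+ 6 / 1) :* K))))
        refl o K q′ ⟩
  o * q′ * (u₁ * (u₂ * u₃))
    ≡⟨ cong (_* (u₁ * (u₂ * u₃))) (oddProduct⁻¹-suc (suc k) (4 ℕ.+ k ℕ.* 2)) ⟨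
  Q k * o₁ * o₂ * o₃ * (u₁ * (u₂ * u₃))
    ≡⟨ solve 7 (λ q o₁ o₂ o₃ u₁ u₂ u₃ → q :* o₁ :* o₂ :* o₃ :* (u₁ :* (u₂ :* u₃))
          := q :* ((o₁ :* u₁) :* ((o₂ :* u₂) :* (o₃ :* u₃)))) refl (Q k) o₁ o₂ o₃ u₁ u₂ u₃ ⟩
  Q k * ((o₁ * u₁) * ((o₂ * u₂) * (o₃ * u₃)))
    ≡⟨ cong₂ (λ x y → Q k * (x * y)) (inv 2) (cong₂ _*_ (inv 3) (inv 4)) ⟩
  Q k * 1ℚ
    ≡⟨ *-identityʳ (Q k) ⟩
  Q k ∎
  where
  open ≡-Reasoning
  open +-*-Solver
  K = ι k
  q′ = Q (suc k)
  o = odd⁻¹ (suc k)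
  o₁ = odd⁻¹ (suc k ℕ.+ (2 ℕ.+ k ℕ.* 2))
  o₂ = odd⁻¹ (suc k ℕ.+ (3 ℕ.+ k ℕ.* 2))
  o₃ = odd⁻¹ (suc k ℕ.+ (4 ℕ.+ k ℕ.* 2))
  u₁ = + 7 / 1 + + 6 / 1 * K
  u₂ = + 9 / 1 + + 6 / 1 * K
  u₃ = + 11 / 1 + + 6 / 1 * K
  expand : ∀ q x → q * x ≡ 1ℚ * q * x
  expand q x = cong (_* x) (sym (*-identityˡ q))
  inv : ∀ c → odd⁻¹ (suc k ℕ.+ (c ℕ.+ k ℕ.* 2)) * ((+ 3 / 1 + (+ c / 1 + + c / 1)) + + 6 / 1 * K) ≡ 1ℚ
  inv c = subst (λ x → odd⁻¹ (suc k ℕ.+ (c ℕ.+ k ℕ.* 2)) * ((+ 3 / 1 + (x + x)) + + 6 / 1 * K) ≡ 1ℚ) (ι-def c) (inverse-3k k c)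
  o-inv : o * (+ 3 / 1 + + 2 / 1 * K) ≡ 1ℚ
  o-inv = trans (cong (o *_) (solve 1 (λ K → con (+ 3 / 1) :+ con (+ 2 / 1) :* K
        := con 1ℚ :+ ((con 1ℚ :+ K) :+ (con 1ℚ :+ K))) refl K))
    (odd⁻¹-inverse-at (suc k) _ (ι-suc k))

*-÷-unique : ∀ c x y z .{{_ : NonZero y}} → z * y ≡ c * x → c * (x ÷ y) ≡ z
*-÷-unique c x y z eq = begin
  c * (x * 1/ y)    ≡⟨ *-assoc c x (1/ y) ⟨
  c * x * 1/ y      ≡⟨ cong (_* 1/ y) eq ⟨
  z * y * 1/ y      ≡⟨ *-assoc z y (1/ y) ⟩
  z * (y * 1/ y)    ≡⟨ cong (z *_) (*-inverseʳ y) ⟩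
  z * 1ℚ            ≡⟨ *-identityʳ z ⟩
  z                 ∎
  where open ≡-Reasoning

-- The common factor of the three parts of `G k`. By `weight-shifted` it is the hypergeometric
-- prefactor of the series divided by 15.
weight : ℕ → ℚ
weight k = sign k * (evens² k * Q k)

weight-shifted : ∀ k →
  + 15 / 1 * weight k * (shifted (+ 7 / 6) k * shifted (+ 11 / 6) k) ≡ (-1ℤ / 27) ^ k * shifted 1ℚ k ^ 2
-- The constant 15 is 1 / `Q 0` = 3 · 5.
weight-shifted zero    = refl
weight-shifted (suc k) = begin
  + 15 / 1 * (sign (suc k) * (p * (w * w) * q′)) * (s₇ * (+ 7 / 6 + + k / 1) * (s₁₁ * (+ 11 / 6 + + k / 1)))
    ≡⟨ cong₂ (λ t x → + 15 / 1 * (t * (p * ((x + x) * (x + x)) * q′)) * (s₇ * (+ 7 / 6 + + k / 1) * (s₁₁ * (+ 11 / 6 + + k / 1)))) (sign-suc k) (ι-suc k) ⟩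
  + 15 / 1 * (- σ * (p * (w′ * w′) * q′)) * (s₇ * (+ 7 / 6 + + k / 1) * (s₁₁ * (+ 11 / 6 + + k / 1)))
    ≡⟨ cong (λ x → + 15 / 1 * (- σ * (p * (w′ * w′) * q′)) * (s₇ * (+ 7 / 6 + x) * (s₁₁ * (+ 11 / 6 + x)))) (ι-def k) ⟨
  + 15 / 1 * (- σ * (p * (w′ * w′) * q′)) * (s₇ * (+ 7 / 6 + K) * (s₁₁ * (+ 11 / 6 + K)))
    -- By `Q-suc` the ratio of consecutive weights is -4 (k + 1)² / (3 (6k + 7) (6k + 11)). Since
    -- (6k + 7) (6k + 11) = 36 (k + 7/6) (k + 11/6), the constant is -4 / 108 = -1 / 27.
    ≡⟨ solve 6 (λ σ p q s₇ s₁₁ K → let w = (con 1ℚ :+ K) :+ (con 1ℚ :+ K) in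
          con (+ 15 / 1) :* (:- σ :* (p :* (w :* w) :* q)) :* (s₇ :* (con (+ 7 / 6) :+ K) :* (s₁₁ :* (con (+ 11 / 6) :+ K)))
          := con (-1ℤ / 27) :* ((con 1ℚ :+ K) :* (con 1ℚ :+ K)) :*
             (con (+ 15 / 1) :* (σ :* (p :* (q :* (con (+ 3 / 1) :* ((con (+ 7 / 1) :+ con (+ 6 / 1) :* K) :* (con (+ 11 / 1) :+ con (+ 6 / 1) :* K)))))) :* (s₇ :* s₁₁)))
         refl σ p q′ s₇ s₁₁ K ⟩
  -1ℤ / 27 * ((1ℚ + K) * (1ℚ + K)) * (+ 15 / 1 * (σ * (p * (q′ * (+ 3 / 1 * ((+ 7 / 1 + + 6 / 1 * K) * (+ 11 / 1 + + 6 / 1 * K)))))) * (s₇ * s₁₁))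
    ≡⟨ cong (λ x → -1ℤ / 27 * ((1ℚ + K) * (1ℚ + K)) * (+ 15 / 1 * (σ * (p * x)) * (s₇ * s₁₁))) (Q-suc k) ⟩
  -1ℤ / 27 * ((1ℚ + K) * (1ℚ + K)) * (+ 15 / 1 * (σ * (p * Q k)) * (s₇ * s₁₁))
    ≡⟨ cong (-1ℤ / 27 * ((1ℚ + K) * (1ℚ + K)) *_) (weight-shifted k) ⟩
  -1ℤ / 27 * ((1ℚ + K) * (1ℚ + K)) * (z * (s₁ * (s₁ * 1ℚ)))
    ≡⟨ solve 3 (λ K z s → con (-1ℤ / 27) :* ((con 1ℚ :+ K) :* (con 1ℚ :+ K)) :* (z :* (s :* (s :* con 1ℚ)))
         := con (-1ℤ / 27) :* z :* (s :* (con 1ℚ :+ K) :* (s :* (con 1ℚ :+ K) :* con 1ℚ))) refl K z s₁ ⟩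
  -1ℤ / 27 * z * (s₁ * (1ℚ + K) * (s₁ * (1ℚ + K) * 1ℚ))
    ≡⟨ cong (λ x → -1ℤ / 27 * z * (s₁ * (1ℚ + x) * (s₁ * (1ℚ + x) * 1ℚ))) (ι-def k) ⟩
  (-1ℤ / 27) ^ suc k * shifted 1ℚ (suc k) ^ 2 ∎
  where
  open ≡-Reasoning
  open +-*-Solver
  K = ι k
  σ = sign k
  p = evens² k
  w = ι (suc k) + ι (suc k)
  w′ = (1ℚ + K) + (1ℚ + K)
  q′ = Q (suc k)
  s₁ = shifted 1ℚ k
  s₇ = shifted (+ 7 / 6) k
  s₁₁ = shifted (+ 11 / 6) k
  z = (-1ℤ / 27) ^ k

-- With V = 6k + 5, the odd product of `F k (suc k)` ends at 6k + 3 and is V times `Q k`. That of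
-- `F k k` runs from 2k + 1 to 6k + 1, which brings the further factor (6k + 3) / (2k + 1) = 3.
G-weight : ∀ k → let a = odd⁻¹ (k ℕ.+ k); b = odd⁻¹ (k ℕ.+ suc k); V = + 5 / 1 + + 6 / 1 * ι k in
  G k ≡ weight k * (+ 3 / 1 * V * (a * a * a - h k * a) - V * (b * b * b - h k * b) - ½ * h k)
G-weight k = begin
  σ * (p * q₀) * (a * a * a - h k * a) + sign (suc k) * (p * q₁) * (b * b * b - h k * b) - ½ * σ * (p * Q k * h k)
    ≡⟨ cong₂ (λ x t → σ * (p * x) * (a * a * a - h k * a) + t * (p * q₁) * (b * b * b - h k * b) - ½ * σ * (p * Q k * h k)) q₀≡ (sign-suc k) ⟩
  σ * (p * (Q k * (+ 3 / 1 * V))) * (a * a * a - h k * a) + - σ * (p * q₁) * (b * b * b - h k * b) - ½ * σ * (p * Q k * h k)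
    ≡⟨ cong (λ x → σ * (p * (Q k * (+ 3 / 1 * V))) * (a * a * a - h k * a) + - σ * (p * x) * (b * b * b - h k * b) - ½ * σ * (p * Q k * h k)) q₁≡ ⟩
  σ * (p * (Q k * (+ 3 / 1 * V))) * (a * a * a - h k * a) + - σ * (p * (Q k * V)) * (b * b * b - h k * b) - ½ * σ * (p * Q k * h k)
    ≡⟨ solve 7 (λ σ p q V x y h →
         σ :* (p :* (q :* (con (+ 3 / 1) :* V))) :* x :+ :- σ :* (p :* (q :* V)) :* y :- con ½ :* σ :* (p :* q :* h)
         := σ :* (p :* q) :* (con (+ 3 / 1) :* V :* x :- V :* y :- con ½ :* h)) refl
         σ p (Q k) V (a * a * a - h k * a) (b * b * b - h k * b) (h k) ⟩
  weight k * (+ 3 / 1 * V * (a * a * a - h k * a) - V * (b * b * b - h k * b) - ½ * h k) ∎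
  where
  open ≡-Reasoning
  open +-*-Solver
  K = ι k
  V = + 5 / 1 + + 6 / 1 * K
  σ = sign k
  p = evens² k
  a = odd⁻¹ (k ℕ.+ k)
  b = odd⁻¹ (k ℕ.+ suc k)
  q₀ = oddProduct⁻¹ k (1 ℕ.+ k ℕ.* 2)
  q₁ = oddProduct⁻¹ (suc k) (1 ℕ.+ k ℕ.* 2)
  o = odd⁻¹ (suc k ℕ.+ (1 ℕ.+ k ℕ.* 2))
  oV : o * V ≡ 1ℚ
  oV = subst (λ x → o * ((+ 3 / 1 + (x + x)) + + 6 / 1 * K) ≡ 1ℚ) (ι-def 1) (inverse-3k k 1)
  q₁≡ : q₁ ≡ Q k * V
  q₁≡ = begin
    q₁             ≡⟨ *-identityʳ q₁ ⟨
    q₁ * 1ℚ        ≡⟨ cong (q₁ *_) oV ⟨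
    q₁ * (o * V)   ≡⟨ *-assoc q₁ o V ⟨
    Q k * V        ∎
  c = odd⁻¹ k
  d = odd⁻¹ (k ℕ.+ (1 ℕ.+ k ℕ.* 2))
  cC : c * (1ℚ + (K + K)) ≡ 1ℚ
  cC = odd⁻¹-inverse k
  dD : d * (+ 3 / 1 * (1ℚ + (K + K))) ≡ 1ℚ
  dD = trans (cong (d *_) (solve 1 (λ K → let x = K :+ (con 1ℚ :+ (K :+ K)) in
        con (+ 3 / 1) :* (con 1ℚ :+ (K :+ K)) := con 1ℚ :+ (x :+ x)) refl K))
    (odd⁻¹-inverse-at _ _ (trans (ι-+ k _) (cong (λ x → K + x) (trans (ι-suc _) (cong (λ x → 1ℚ + x) (ι-k*2 k))))))
  q₀≡ : q₀ ≡ Q k * (+ 3 / 1 * V)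
  q₀≡ = begin
    q₀
      ≡⟨ *-identityʳ q₀ ⟨
    q₀ * 1ℚ
      ≡⟨ cong (q₀ *_) dD ⟨
    q₀ * (d * (+ 3 / 1 * (1ℚ + (K + K))))
      ≡⟨ solve 3 (λ q d K → q :* (d :* (con (+ 3 / 1) :* (con 1ℚ :+ (K :+ K)))) := q :* d :* (con (+ 3 / 1) :* (con 1ℚ :+ (K :+ K)))) refl q₀ d K ⟩
    q₀ * d * (+ 3 / 1 * (1ℚ + (K + K)))
      ≡⟨ cong (_* (+ 3 / 1 * (1ℚ + (K + K)))) (oddProduct⁻¹-suc k (1 ℕ.+ k ℕ.* 2)) ⟩
    c * q₁ * (+ 3 / 1 * (1ℚ + (K + K)))
      ≡⟨ solve 3 (λ c q K → c :* q :* (con (+ 3 / 1) :* (con 1ℚ :+ (K :+ K))) := (c :* (con 1ℚ :+ (K :+ K))) :* (con (+ 3 / 1) :* q)) refl c q₁ K ⟩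
    c * (1ℚ + (K + K)) * (+ 3 / 1 * q₁)
      ≡⟨ cong₂ (λ x y → x * (+ 3 / 1 * y)) cC q₁≡ ⟩
    1ℚ * (+ 3 / 1 * (Q k * V))
      ≡⟨ solve 2 (λ q V → con 1ℚ :* (con (+ 3 / 1) :* (q :* V)) := q :* (con (+ 3 / 1) :* V)) refl (Q k) V ⟩
    Q k * (+ 3 / 1 * V) ∎

-- With M = 4K + 1 and N = 4K + 3, this comes down to 3VN - VM + MN / 2 = (112K² + 192K + 83) / 2
-- for the part with `H`, and to 3N³ - M³ = 8 (16K³ + 48K² + 39K + 10) for the rest.
bracket-identity : ∀ a b K H → let h = + 1 / 4 * H; V = + 5 / 1 + + 6 / 1 * K in
  a * (1ℚ + + 4 / 1 * K) ≡ 1ℚ → b * (+ 3 / 1 + + 4 / 1 * K) ≡ 1ℚ →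
  + 15 / 1 * ((+ 83 / 1 + + 192 / 1 * K + + 112 / 1 * (K * K)) * (+ 1 / 64 * (a * b)) * H
    - V * (+ 10 / 1 + + 39 / 1 * K + + 48 / 1 * (K * K) + + 16 / 1 * (K * (K * K))) * (a * a * a * (b * b * b)))
  ≡ - (+ 15 / 8) * (+ 3 / 1 * V * (a * a * a - h * a) - V * (b * b * b - h * b) - ½ * h)
bracket-identity a b K H aM bN = begin
  + 15 / 1 * ((+ 83 / 1 + + 192 / 1 * K + + 112 / 1 * (K * K)) * (+ 1 / 64 * (a * b)) * H
    - V * (+ 10 / 1 + + 39 / 1 * K + + 48 / 1 * (K * K) + + 16 / 1 * (K * (K * K))) * (a * a * a * (b * b * b)))
    ≡⟨ solve 4 (λ a b K H → let V = con (+ 5 / 1) :+ con (+ 6 / 1) :* K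
                                x = a :* (con 1ℚ :+ con (+ 4 / 1) :* K)
                                y = b :* (con (+ 3 / 1) :+ con (+ 4 / 1) :* K)
                                h = con (+ 1 / 4) :* H in
         con (+ 15 / 1) :* ((con (+ 83 / 1) :+ con (+ 192 / 1) :* K :+ con (+ 112 / 1) :* (K :* K)) :* (con (+ 1 / 64) :* (a :* b)) :* H
           :- V :* (con (+ 10 / 1) :+ con (+ 39 / 1) :* K :+ con (+ 48 / 1) :* (K :* K) :+ con (+ 16 / 1) :* (K :* (K :* K))) :* (a :* a :* a :* (b :* b :* b)))
         -- The factors `x` and `y`, both equal to 1, bring all terms over the denominator of the
         -- left side, so that a polynomial identity remains.
         := con (- (+ 15 / 8)) :* (con (+ 3 / 1) :* V :* (a :* a :* a :* (y :* y :* y) :- h :* a :* y)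
              :- V :* (b :* b :* b :* (x :* x :* x) :- h :* b :* x) :- con ½ :* h :* (x :* y))) refl a b K H ⟩
  body (a * (1ℚ + + 4 / 1 * K)) (b * (+ 3 / 1 + + 4 / 1 * K))
    ≡⟨ cong₂ body aM bN ⟩
  body 1ℚ 1ℚ
    ≡⟨ solve 4 (λ a b V h →
        con (- (+ 15 / 8)) :* (con (+ 3 / 1) :* V :* (a :* a :* a :* con 1ℚ :- h :* a :* con 1ℚ)
              :- V :* (b :* b :* b :* con 1ℚ :- h :* b :* con 1ℚ) :- con ½ :* h :* con 1ℚ)
        := con (- (+ 15 / 8)) :* (con (+ 3 / 1) :* V :* (a :* a :* a :- h :* a) :- V :* (b :* b :* b :- h :* b) :- con ½ :* h))
        refl a b V h′ ⟩
  - (+ 15 / 8) * (+ 3 / 1 * V * (a * a * a - h′ * a) - V * (b * b * b - h′ * b) - ½ * h′) ∎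
  where
  open ≡-Reasoning
  open +-*-Solver
  h′ = + 1 / 4 * H
  V = + 5 / 1 + + 6 / 1 * K
  body : ℚ → ℚ → ℚ
  body x y = - (+ 15 / 8) * (+ 3 / 1 * V * (a * a * a * (y * y * y) - h′ * a * y)
              - V * (b * b * b * (x * x * x) - h′ * b * x) - ½ * h′ * (x * y))

-- The terms of the series are multiples of G k.

summand : ℕ → ℚ
summand k =
  (-1ℤ / 27) ^ k
  * (shifted 1ℚ k ^ 2 ÷ (shifted (+ 7 / 6) k * shifted (+ 11 / 6) k))
      {{shifted-*-nonZero (+ 7 / 6) (+ 11 / 6) k}}
  * ( + (83 ℕ.+ 192 ℕ.* k ℕ.+ 112 ℕ.* k ℕ.^ 2)
        / (64 ℕ.* (1 ℕ.+ 4 ℕ.* k) ℕ.* (3 ℕ.+ 4 ℕ.* k))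
      * H⁽²⁾ k
    - + ((5 ℕ.+ 6 ℕ.* k) ℕ.* (10 ℕ.+ 39 ℕ.* k ℕ.+ 48 ℕ.* k ℕ.^ 2 ℕ.+ 16 ℕ.* k ℕ.^ 3))
        / ((1 ℕ.+ 4 ℕ.* k) ℕ.^ 3 ℕ.* (3 ℕ.+ 4 ℕ.* k) ℕ.^ 3))

ι-^3 : ∀ k → ι (k ℕ.^ 3) ≡ ι k * (ι k * ι k)
ι-^3 k = trans (ι-* k (k ℕ.^ 2)) (cong (ι k *_) (ι-^2 k))

ι-add-* : ∀ m d n x y → ι m ≡ x → ι n ≡ y → ι (m ℕ.+ d ℕ.* n) ≡ x + + d / 1 * y
ι-add-* m d n x y refl refl = trans (ι-+ m (d ℕ.* n))
  (cong (λ z → ι m + z) (trans (ι-* d n) (cong (_* ι n) (ι-def d))))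

ι-linear : ∀ c d k → ι (c ℕ.+ d ℕ.* k) ≡ + c / 1 + + d / 1 * ι k
ι-linear c d k = ι-add-* c d k (+ c / 1) (ι k) (ι-def c) refl

summand≡-15/8*G : ∀ k → summand k ≡ - (+ 15 / 8) * G k
summand≡-15/8*G k = begin
  summand k
    ≡⟨ cong₂ (λ x y → x * (y * H⁽²⁾ k - z)) pre c₁ ⟩
  + 15 / 1 * weight k * (y′ * H⁽²⁾ k - z)
    ≡⟨ cong (λ z → + 15 / 1 * weight k * (y′ * H⁽²⁾ k - z)) c₂ ⟩
  + 15 / 1 * weight k * (y′ * H⁽²⁾ k - z′)
    ≡⟨ solve 2 (λ w x → con (+ 15 / 1) :* w :* x := w :* (con (+ 15 / 1) :* x)) refl (weight k) (y′ * H⁽²⁾ k - z′) ⟩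
  weight k * (+ 15 / 1 * (y′ * H⁽²⁾ k - z′))
    ≡⟨ cong (weight k *_) (bracket-identity a b K (H⁽²⁾ k) aM bN) ⟩
  weight k * (- (+ 15 / 8) * B)
    ≡⟨ solve 3 (λ w c x → w :* (c :* x) := c :* (w :* x)) refl (weight k) (- (+ 15 / 8)) B ⟩
  - (+ 15 / 8) * (weight k * B)
    ≡⟨ cong (- (+ 15 / 8) *_) (G-weight k) ⟨
  - (+ 15 / 8) * G k ∎
  where
  open ≡-Reasoning
  open +-*-Solver
  K = ι k
  a = odd⁻¹ (k ℕ.+ k)
  b = odd⁻¹ (k ℕ.+ suc k)
  V = + 5 / 1 + + 6 / 1 * K
  B = + 3 / 1 * V * (a * a * a - h k * a) - V * (b * b * b - h k * b) - ½ * h k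
  M = 1ℚ + + 4 / 1 * K
  N = + 3 / 1 + + 4 / 1 * K
  num₁ = 83 ℕ.+ 192 ℕ.* k ℕ.+ 112 ℕ.* k ℕ.^ 2
  den₁ = 64 ℕ.* (1 ℕ.+ 4 ℕ.* k) ℕ.* (3 ℕ.+ 4 ℕ.* k)
  cubic = 10 ℕ.+ 39 ℕ.* k ℕ.+ 48 ℕ.* k ℕ.^ 2 ℕ.+ 16 ℕ.* k ℕ.^ 3
  num₂ = (5 ℕ.+ 6 ℕ.* k) ℕ.* cubic
  den₂ = (1 ℕ.+ 4 ℕ.* k) ℕ.^ 3 ℕ.* (3 ℕ.+ 4 ℕ.* k) ℕ.^ 3
  z = + num₂ / den₂
  y′ = (+ 83 / 1 + + 192 / 1 * K + + 112 / 1 * (K * K)) * (+ 1 / 64 * (a * b))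
  P = + 10 / 1 + + 39 / 1 * K + + 48 / 1 * (K * K) + + 16 / 1 * (K * (K * K))
  z′ = V * P * (a * a * a * (b * b * b))
  aM : a * M ≡ 1ℚ
  aM = trans (cong (a *_) (solve 1 (λ K → con 1ℚ :+ con (+ 4 / 1) :* K := con 1ℚ :+ ((K :+ K) :+ (K :+ K))) refl K))
    (odd⁻¹-inverse-at _ _ (ι-+ k k))
  bN : b * N ≡ 1ℚ
  bN = trans (cong (b *_) (solve 1 (λ K → let x = K :+ (con 1ℚ :+ K) in con (+ 3 / 1) :+ con (+ 4 / 1) :* K := con 1ℚ :+ (x :+ x)) refl K))
    (odd⁻¹-inverse-at _ _ (trans (ι-+ k (suc k)) (cong (λ x → K + x) (ι-suc k))))
  pre : ((-1ℤ / 27) ^ k * (shifted 1ℚ k ^ 2 ÷ (shifted (+ 7 / 6) k * shifted (+ 11 / 6) k))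
            {{shifted-*-nonZero (+ 7 / 6) (+ 11 / 6) k}}) ≡ + 15 / 1 * weight k
  pre = *-÷-unique ((-1ℤ / 27) ^ k) (shifted 1ℚ k ^ 2) (shifted (+ 7 / 6) k * shifted (+ 11 / 6) k)
    (+ 15 / 1 * weight k) {{shifted-*-nonZero (+ 7 / 6) (+ 11 / 6) k}} (weight-shifted k)
  c₁ : + num₁ / den₁ ≡ y′
  c₁ = /-unique y′ num₁ den₁ (begin
    y′ * ι den₁
      ≡⟨ cong (y′ *_) (trans (ι-* (64 ℕ.* (1 ℕ.+ 4 ℕ.* k)) (3 ℕ.+ 4 ℕ.* k)) (cong₂ _*_
           (trans (ι-* 64 (1 ℕ.+ 4 ℕ.* k)) (cong₂ _*_ (ι-def 64) (ι-linear 1 4 k))) (ι-linear 3 4 k))) ⟩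
    y′ * (+ 64 / 1 * M * N)
      ≡⟨ solve 5 (λ p a b M N → p :* (con (+ 1 / 64) :* (a :* b)) :* (con (+ 64 / 1) :* M :* N)
            := p :* ((a :* M) :* (b :* N))) refl (+ 83 / 1 + + 192 / 1 * K + + 112 / 1 * (K * K)) a b M N ⟩
    (+ 83 / 1 + + 192 / 1 * K + + 112 / 1 * (K * K)) * ((a * M) * (b * N))
      ≡⟨ cong₂ (λ x y → (+ 83 / 1 + + 192 / 1 * K + + 112 / 1 * (K * K)) * (x * y)) aM bN ⟩
    (+ 83 / 1 + + 192 / 1 * K + + 112 / 1 * (K * K)) * 1ℚ
      ≡⟨ *-identityʳ _ ⟩
    + 83 / 1 + + 192 / 1 * K + + 112 / 1 * (K * K)
      ≡⟨ ι-add-* (83 ℕ.+ 192 ℕ.* k) 112 (k ℕ.^ 2) _ _ (ι-linear 83 192 k) (ι-^2 k) ⟨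
    ι num₁ ∎)
  c₂ : z ≡ z′
  c₂ = /-unique z′ num₂ den₂ {{ℕ.m*n≢0 ((1 ℕ.+ 4 ℕ.* k) ℕ.^ 3) ((3 ℕ.+ 4 ℕ.* k) ℕ.^ 3)}} (begin
    z′ * ι den₂
      ≡⟨ cong (z′ *_) (trans (ι-* ((1 ℕ.+ 4 ℕ.* k) ℕ.^ 3) ((3 ℕ.+ 4 ℕ.* k) ℕ.^ 3)) (cong₂ _*_
           (trans (ι-^3 (1 ℕ.+ 4 ℕ.* k)) (cong (λ x → x * (x * x)) (ι-linear 1 4 k)))
           (trans (ι-^3 (3 ℕ.+ 4 ℕ.* k)) (cong (λ x → x * (x * x)) (ι-linear 3 4 k))))) ⟩
    z′ * (M * (M * M) * (N * (N * N)))
      ≡⟨ solve 5 (λ p a b M N → p :* (a :* a :* a :* (b :* b :* b)) :* (M :* (M :* M) :* (N :* (N :* N)))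
            := p :* ((a :* M) :* ((a :* M) :* (a :* M)) :* ((b :* N) :* ((b :* N) :* (b :* N))))) refl (V * P) a b M N ⟩
    V * P * ((a * M) * ((a * M) * (a * M)) * ((b * N) * ((b * N) * (b * N))))
      ≡⟨ cong₂ (λ x y → V * P * (x * (x * x) * (y * (y * y)))) aM bN ⟩
    V * P * 1ℚ
      ≡⟨ *-identityʳ (V * P) ⟩
    V * P
      ≡⟨ trans (ι-* (5 ℕ.+ 6 ℕ.* k) cubic) (cong₂ _*_ (ι-linear 5 6 k)
           (ι-add-* _ 16 (k ℕ.^ 3) _ _
             (ι-add-* _ 48 (k ℕ.^ 2) _ _ (ι-linear 10 39 k) (ι-^2 k)) (ι-^3 k))) ⟨
    ι num₂ ∎)

-- Convergence of the series.

∑summand : ∀ n → ∑[ n ] summand ≡ - (+ 15 / 8) * (∑[ n ℕ.* 2 ] β4-term - error 0 n)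
∑summand n = begin
  ∑[ n ] summand
    ≡⟨ trans (∑-cong summand≡-15/8*G n) (∑-*ˡ (- (+ 15 / 8)) G n) ⟩
  - (+ 15 / 8) * ∑[ n ] G
    ≡⟨ cong (λ m → - (+ 15 / 8) * ∑[ m ] G) (ℕ.+-identityʳ n) ⟨
  - (+ 15 / 8) * ∑[ n ℕ.+ 0 ] G
    ≡⟨ cong (- (+ 15 / 8) *_) (∑G n 0) ⟩
  - (+ 15 / 8) * (0ℚ + T 0 (n ℕ.* 2) - error 0 n)
    ≡⟨ cong (λ x → - (+ 15 / 8) * (x - error 0 n))
         (trans (+-identityˡ (T 0 (n ℕ.* 2))) (T-zero (n ℕ.* 2))) ⟩
  - (+ 15 / 8) * (∑[ n ℕ.* 2 ] β4-term - error 0 n) ∎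
  where open ≡-Reasoning

theorem1p6 : HasSum
    (λ k →
    (-1ℤ / 27) ^ k
    * (shifted 1ℚ k ^ 2 ÷ (shifted (+ 7 / 6) k * shifted (+ 11 / 6) k))
    {{shifted-*-nonZero (+ 7 / 6) (+ 11 / 6) k}}
    * ( + (83 ℕ.+ 192 ℕ.* k ℕ.+ 112 ℕ.* k ℕ.^ 2)
    / (64 ℕ.* (1 ℕ.+ 4 ℕ.* k) ℕ.* (3 ℕ.+ 4 ℕ.* k))
    * H⁽²⁾ k
    - + ((5 ℕ.+ 6 ℕ.* k) ℕ.* (10 ℕ.+ 39 ℕ.* k ℕ.+ 48 ℕ.* k ℕ.^ 2 ℕ.+ 16 ℕ.* k ℕ.^ 3))
    / ((1 ℕ.+ 4 ℕ.* k) ℕ.^ 3 ℕ.* (3 ℕ.+ 4 ℕ.* k) ℕ.^ 3)))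
    ((- (+ 15 / 8)) · β4)
theorem1p6 ε 0<ε =
  let N₁ , β4-near = β4-cauchy η 0<η
      N₂ , bound<η = bound<ε η 0<η
  -- `½ * ε` is the uniform gap required by `_<ᴿ_`, so the distance must stay within the other half.
  -- N₁ controls the partial sums of β(4), of lengths `n * 2` and m; N₂ controls the error.
  in N₁ ℕ.⊔ N₂ , λ n N≤n → ½ * ε , 0<½*ε 0<ε , N₁ , λ m N₁≤m →
    let S = ∑[ n ℕ.* 2 ] β4-term
        S′ = ∑[ m ] β4-term
        E = error 0 n
    in begin
    ∣ ∑[ n ] summand - c * S′ ∣ + ½ * ε
      ≡⟨ cong (λ x → ∣ x - c * S′ ∣ + ½ * ε) (∑summand n) ⟩
    ∣ c * (S - E) - c * S′ ∣ + ½ * ε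
      ≡⟨ cong (λ x → ∣ x ∣ + ½ * ε)
           (solve 4 (λ c s e s′ → c :* (s :- e) :- c :* s′ := c :* ((s :- s′) :- e)) refl c S E S′) ⟩
    ∣ c * ((S - S′) - E) ∣ + ½ * ε
      ≡⟨ cong (_+ ½ * ε) (∣p*q∣≡∣p∣*∣q∣ c ((S - S′) - E)) ⟩
    + 15 / 8 * ∣ (S - S′) - E ∣ + ½ * ε
      ≤⟨ +-monoˡ-≤ (½ * ε) (*-monoˡ-≤-nonNeg (+ 15 / 8) (≤-trans (∣p-q∣≤∣p∣+∣q∣ (S - S′) E)
           (+-mono-≤
             (<⇒≤ (β4-near (n ℕ.* 2) m (ℕ.≤-trans (ℕ.m⊔n≤o⇒m≤o N₁ N₂ N≤n) (ℕ.m≤m*n n 2)) N₁≤m))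
             (≤-trans (∣error∣≤bound n) (<⇒≤ (bound<η n (ℕ.m⊔n≤o⇒n≤o N₁ N₂ N≤n))))))) ⟩
    + 15 / 8 * (η + η) + ½ * ε
      ≡⟨ solve 1 (λ ε → con (+ 15 / 8) :* (con (+ 2 / 15) :* ε :+ con (+ 2 / 15) :* ε) :+ con ½ :* ε := ε) refl ε ⟩
    ε ∎
  where
  open ≤-Reasoning
  open +-*-Solver
  c = - (+ 15 / 8)
  -- Two errors of size η, scaled by 15 / 8, add up to `½ * ε`.
  η = + 2 / 15 * ε
  0<η : 0ℚ < η
  0<η = subst (_< η) (*-zeroʳ (+ 2 / 15)) (*-monoʳ-<-pos (+ 2 / 15) 0<ε)
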